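{- Let $n\ge0$ and let $\sigma,\tau\in\mathrm{Typ}(n)$ be types of $n$. The coefficient of $H_\tau$ in the expansion of $E^+_\sigma$ in the basis $\{H_\rho:\rho\in\mathrm{Typ}(n)\}$ is $$\sum_{T\in \mathcal{PT}_H^{\mathrm{doub}}(\sigma, \tau)} (-1)^{\ell_2(T)}.$$
   Context: A type of $n$ is a sequence $\tau=(\tau|^1,\tau|^2,\dots)$ of (possibly empty) integer partitions with $\sum_{i\ge1} i\,|\tau|^i|=n$, where $|\tau|^i|$ is the size of the partition $\tau|^i$; $\mathrm{Typ}(n)$ is the set of types of $n$. Each part $d$ of $\tau|^r$ gives a block $d^r$ of $\tau$ (degree $d$, multiplicity $r$; not exponentiation); a type is thus a multiset of blocks. Let $x_{i,j}$ ($i,j\ge 1$) be indeterminates with $\deg x_{i,j}=i$; all series have rational coefficients. A monomial is square-free if every exponent is at most $1$. $H_d$ is the sum of all monomials of degree $d$; $E^+_d$ is the sum of all square-free monomials of degree $d$. For $F\in\{H,E^+\}$, $F_{d^r}$ is obtained from $F_d$ by replacing each $x_{i,j}$ by $x_{i,j}^r$, and $F_\tau=\prod F_{d^r}$ over all blocks $d^r$ of $\tau$ (counted with repetition; empty product $=1$). It is known that $\{F_\tau\}_{\tau\in\mathrm{Typ}(n)}$ is, for each such $F$, a $\mathbb{Q}$-basis of the space $\mathrm{PSym}(n)$ of polysymmetric functions of degree $n$ (power series homogeneous of degree $n$ that are symmetric separately in each variable set $\{x_{i,j}\}_{j\ge1}$). The diagram of a partition $\lambda$ has left-justified rows of $\lambda_1,\lambda_2,\dots$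 cells; the tensor diagram of $\sigma$ is the sequence of diagrams of $\sigma|^1,\sigma|^2,\dots$, the $i$th one being called the $i$th tensor factor. A brick is a nonempty set of consecutive cells in one row; its length is its number of cells. A doublebrick is a brick of even length marked with a $+$ sign (and is distinguished from unmarked bricks, simply called bricks). A double polybrick tabloid of shape $\sigma$ and content $\tau$ is a decomposition of the tensor diagram of $\sigma$ into disjoint bricks and doublebricks such that, in each row, all doublebricks appear to the right of all bricks, and such that $\tau$ is the multiset of blocks obtained by taking a block $a^m$ for each brick of length $a$ in the $m$th tensor factor and a block $b^{2m}$ for each doublebrick of length $2b$ in the $m$th tensor factor. $\mathcal{PT}_H^{\mathrm{doub}}(\sigma,\tau)$ is the set of double polybrick tabloids of shape $\sigma$ and content $\tau$ with at most one (unmarked) brick in each row. For such $T$, $\ell_2(T)$ is the number of doublebricks in $T$. -}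

module Defs where

open import Data.Bool.Base using (Bool; true; false; T; not; if_then_else_)
open import Data.Bool.Properties using (T?)
open import Data.Irrelevant using (Irrelevant; [_])
open import Data.List.Base
  using (List; []; _∷_; _++_; map; foldr; concat; length; upTo;
         filterᵇ; cartesianProductWith)
open import Data.List.Membership.Propositional using (_∈_)
open import Data.List.Membership.Propositional.Properties
  using (∈-++⁺ˡ; ∈-++⁺ʳ; ∈-map⁺; ∈-map⁻; ∈-upTo⁺; ∈-∃++;
         ∈-cartesianProductWith⁺; ∈-cartesianProductWith⁻)
open import Data.List.Relation.Binary.Permutation.Propositional
  using (_↭_; ↭-refl; ↭-sym; ↭-trans; prep)
open import Data.List.Relation.Binary.Permutation.Propositional.Properties
  using (shift; drop-∷; ∈-resp-↭; ↭-empty-inv)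
open import Data.List.Relation.Binary.Pointwise.Base using (Pointwise; []; _∷_)
import Data.List.Relation.Binary.Pointwise as Pw
open import Data.List.Relation.Unary.All as All using (All; []; _∷_; reduce)
open import Data.List.Relation.Unary.AllPairs as AllPairs
  using (AllPairs; []; _∷_)
open import Data.List.Relation.Unary.Any using (here; there)
open import Data.List.Relation.Unary.Linked using (Linked; linked?)
open import Data.List.Relation.Unary.Unique.Propositional using (Unique)
open import Data.List.Relation.Unary.Unique.Propositional.Properties
  using (map⁺; ++⁺; upTo⁺; cartesianProductWith⁺)
open import Data.Nat.Base as ℕ
  using (ℕ; zero; suc; _∸_; _/_; _≤_; _≥_; z≤n; s≤s; NonZero)
open import Data.Nat.DivMod using (0/n≡0)
open import Data.Nat.Divisibility using (_∣_; _∣?_; _∣0)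
open import Data.Nat.ListAction using (sum)
import Data.Nat.Properties as ℕ
open import Data.Product using (_×_; _,_; Σ; ∃!; proj₁; proj₂)
open import Data.Rational.Base as ℚ using (ℚ; 0ℚ; 1ℚ; _*_)
open import Algebra.Definitions.RawSemiring ℚ.+-*-rawSemiring public using (_^_)
open import Data.Refinement
  using (Refinement; Refinement-syntax; _,_; value; proof)
open import Data.Vec.Base as Vec using (Vec; []; _∷_; toList)
open import Function.Base using (_∘_; id)
open import Function.Bundles using (_⇔_; mk⇔; Equivalence)
open import Relation.Binary.Core using (Rel)
open import Relation.Binary.Definitions using (DecidableEquality)
open import Relation.Binary.PropositionalEquality
open import Relation.Nullary.Decidable
  using (Dec; yes; no; does; map′; recompute; _×-dec_; _→-dec_; dec-true;
         dec-false)
open import Relation.Nullary.Negation using (contradiction)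
open import Relation.Unary using (Pred; Decidable)
open import Level using (0ℓ)

private
  variable
    A B : Set
    n : ℕ

record Enumeration (A : Set) : Set where
  field
    elements : List A
    complete : ∀ x → x ∈ elements
    unique   : Unique elements

sumℚ : List ℚ → ℚ
sumℚ = foldr ℚ._+_ 0ℚ

∑ : Enumeration A → (A → ℚ) → ℚ
∑ E f = sumℚ (map f (Enumeration.elements E))

extract : Dec A → Irrelevant A → A
extract A? [ a ] = recompute A? a

module _ {P : Pred A 0ℓ} (P? : Decidable P) where

  refine : List A → List [ x ∈ A ∣ P x ]
  refine []       = []
  refine (x ∷ xs) with P? x
  ... | yes p = (x , [ p ]) ∷ refine xs
  ... | no  _ = refine xs

  ∈-refine⁺ : ∀ {xs} (r : [ x ∈ A ∣ P x ]) → value r ∈ xs → r ∈ refine xs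
  ∈-refine⁺ {x ∷ xs} r x∈ with P? x
  ∈-refine⁺ r       (here refl) | yes p = here refl
  ∈-refine⁺ r       (there x∈)  | yes p = there (∈-refine⁺ r x∈)
  ∈-refine⁺ (y , q) (here refl) | no ¬p =
    contradiction (extract (P? y) q) ¬p
  ∈-refine⁺ r       (there x∈)  | no ¬p = ∈-refine⁺ r x∈

  ∈-refine⁻ : ∀ {xs} {r : [ x ∈ A ∣ P x ]} → r ∈ refine xs → value r ∈ xs
  ∈-refine⁻ {x ∷ xs} r∈ with P? x
  ∈-refine⁻ (here refl) | yes p = here refl
  ∈-refine⁻ (there r∈)  | yes p = there (∈-refine⁻ r∈)
  ∈-refine⁻ r∈          | no _  = there (∈-refine⁻ r∈)

  refine-unique : ∀ {xs} → Unique xs → Unique (refine xs)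
  refine-unique {[]}     []         = []
  refine-unique {x ∷ xs} (x∉ ∷ xs!) with P? x
  ... | yes p = All.tabulate (λ r∈ eq →
                  All.lookup x∉ (∈-refine⁻ r∈) (cong value eq))
                ∷ refine-unique xs!
  ... | no  _ = refine-unique xs!

  refinement : ∀ xs → Unique xs → (∀ x → P x → x ∈ xs) →
               Enumeration [ x ∈ A ∣ P x ]
  refinement xs xs! complete = record
    { elements = refine xs
    ; complete = λ r → ∈-refine⁺ r
        (complete (value r) (extract (P? (value r)) (proof r)))
    ; unique   = refine-unique xs!
    }

listsUpTo : ℕ → List A → List (List A)
listsUpTo zero    xs = [] ∷ []
listsUpTo (suc k) xs = [] ∷ cartesianProductWith _∷_ xs (listsUpTo k xs)

∷-inj : ∀ {x y : A} {xs ys : List A} → x ∷ xs ≡ y ∷ ys → x ≡ y × xs ≡ ys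
∷-inj refl = refl , refl

∈-listsUpTo : ∀ {k} {xs ys : List A} →
              All (_∈ xs) ys → length ys ≤ k → ys ∈ listsUpTo k xs
∈-listsUpTo {k = zero}  []         _       = here refl
∈-listsUpTo {k = suc k} []         _       = here refl
∈-listsUpTo {k = suc k} (y∈ ∷ ys∈) (s≤s l) =
  there (∈-cartesianProductWith⁺ _∷_ y∈ (∈-listsUpTo ys∈ l))

listsUpTo-unique : ∀ k {xs : List A} → Unique xs → Unique (listsUpTo k xs)
listsUpTo-unique zero         xs! = [] ∷ []
listsUpTo-unique (suc k) {xs} xs! =
  All.tabulate (λ { ys∈ refl → nil∉ ys∈ })
  ∷ cartesianProductWith⁺ _∷_ ∷-inj xs! (listsUpTo-unique k xs!)
  where
  nil∉ : [] ∈ cartesianProductWith _∷_ xs (listsUpTo k xs) → _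
  nil∉ nil∈ with () ← proj₂ (proj₂ (proj₂ (proj₂
    (∈-cartesianProductWith⁻ _∷_ xs (listsUpTo k xs) nil∈))))

vectors : ∀ k → List A → List (Vec A k)
vectors zero    xs = [] ∷ []
vectors (suc k) xs = cartesianProductWith _∷_ xs (vectors k xs)

∈-vectors : ∀ {k} {xs : List A} (v : Vec A k) →
            All (_∈ xs) (toList v) → v ∈ vectors k xs
∈-vectors []      []         = here refl
∈-vectors (x ∷ v) (x∈ ∷ v∈) = ∈-cartesianProductWith⁺ _∷_ x∈ (∈-vectors v v∈)

vectors-unique : ∀ k {xs : List A} → Unique xs → Unique (vectors k xs)
vectors-unique zero    xs! = [] ∷ []
vectors-unique (suc k) xs! =
  cartesianProductWith⁺ _∷_ (λ { refl → refl , refl }) xs! (vectors-unique k xs!)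

allEnumeration : {P : A → Set} → (∀ x → Enumeration (P x)) →
                 ∀ xs → Enumeration (All P xs)
allEnumeration E [] = record
  { elements = [] ∷ []
  ; complete = λ { [] → here refl }
  ; unique   = [] ∷ []
  }
allEnumeration E (x ∷ xs) = record
  { elements = cartesianProductWith _∷_ X.elements XS.elements
  ; complete = λ { (p ∷ ps) →
      ∈-cartesianProductWith⁺ _∷_ (X.complete p) (XS.complete ps) }
  ; unique   = cartesianProductWith⁺ _∷_ (λ { refl → refl , refl })
                 X.unique XS.unique
  }
  where
  module X  = Enumeration (E x)
  module XS = Enumeration (allEnumeration E xs)

module _ (w : A → ℕ) where

  length≤total : ∀ xs → All (NonZero ∘ w) xs → length xs ≤ sum (map w xs)
  length≤total []       []         = z≤n
  length≤total (x ∷ xs) (nz ∷ nzs) =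
    ℕ.+-mono-≤ (ℕ.>-nonZero⁻¹ (w x) {{nz}}) (length≤total xs nzs)

  each≤total : ∀ xs → All (λ x → w x ≤ sum (map w xs)) xs
  each≤total []       = []
  each≤total (x ∷ xs) = ℕ.m≤m+n (w x) _
    ∷ All.map (λ le → ℕ.≤-trans le (ℕ.m≤n+m _ (w x))) (each≤total xs)

IsPartition : List ℕ → Set
IsPartition ps = All NonZero ps × Linked _≥_ ps

Partition : Set
Partition = [ ps ∈ List ℕ ∣ IsPartition ps ]

size : Partition → ℕ
size = sum ∘ value

-- weight k (s₀ ∷ s₁ ∷ …) = k s₀ + (k + 1) s₁ + …
weight : ℕ → List ℕ → ℕ
weight k []       = 0
weight k (s ∷ ss) = k ℕ.* s ℕ.+ weight (suc k) ss

-- The i-th entry (counting from 1) is τ|ⁱ.  All τ|ⁱ with i > n are empty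
-- because Σ i |τ|ⁱ| = n, so they are not stored.
Typ : ℕ → Set
Typ n = [ τ ∈ Vec Partition n ∣ weight 1 (map size (toList τ)) ≡ n ]

record Block : Set where
  constructor block
  field
    degree        : ℕ
    multiplicity  : ℕ
    .{{nonZero}}  : NonZero multiplicity

open Block public using (degree; multiplicity)

blocksFrom : ∀ k → .{{NonZero k}} → List Partition → List Block
blocksFrom k []       = []
blocksFrom k (p ∷ ps) = map (λ d → block d k) (value p) ++ blocksFrom (suc k) ps

blocks : Typ n → List Block
blocks τ = blocksFrom 1 (toList (value τ))

isPartition? : Decidable IsPartition
isPartition? ps = All.all? ℕ.nonZero? ps ×-dec linked? ℕ._≥?_ ps

partitionsUpTo : ℕ → List Partition
partitionsUpTo n = refine isPartition? (listsUpTo n (upTo (suc n)))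

∈-partitionsUpTo : ∀ (p : Partition) → size p ≤ n → p ∈ partitionsUpTo n
∈-partitionsUpTo (ps , pf) le = ∈-refine⁺ isPartition? (ps , pf) (∈-listsUpTo
  (All.map (λ q → ∈-upTo⁺ (s≤s (ℕ.≤-trans q le′))) (each≤total id ps))
  (ℕ.≤-trans (length≤total id ps
    (proj₁ (extract (isPartition? ps) pf))) le′))
  where
  map-id : ∀ xs → map id xs ≡ xs
  map-id []       = refl
  map-id (x ∷ xs) = cong (x ∷_) (map-id xs)
  le′ : sum (map id ps) ≤ _
  le′ = subst (λ z → sum z ≤ _) (sym (map-id ps)) le

each≤weight : ∀ k → .{{NonZero k}} → (f : A → ℕ) → ∀ xs →
              All (λ x → f x ≤ weight k (map f xs)) xs
each≤weight k f []       = []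
each≤weight k f (x ∷ xs) =
  ℕ.≤-trans (ℕ.m≤n*m (f x) k) (ℕ.m≤m+n _ _)
  ∷ All.map (λ le → ℕ.≤-trans le (ℕ.m≤n+m _ (k ℕ.* f x)))
      (each≤weight (suc k) f xs)

types : ∀ n → Enumeration (Typ n)
types n = refinement (λ v → weight 1 (map size (toList v)) ℕ.≟ n)
  (vectors n (partitionsUpTo n))
  (vectors-unique n (refine-unique isPartition?
    (listsUpTo-unique n (upTo⁺ (suc n)))))
  (λ v eq → ∈-vectors v (All.map
    (λ {p} le → ∈-partitionsUpTo p (subst (size p ≤_) eq le))
    (each≤weight 1 size (toList v))))

entry : A → List A → ℕ → A
entry z []       _       = z
entry z (x ∷ xs) zero    = x
entry z (x ∷ xs) (suc i) = entry z xs i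

-- A monomial in the x_{i,j} is a list of rows of exponents, the i-th row being
-- for the variables x_{i,1}, x_{i,2}, …; missing entries are zero.
Monomial : Set
Monomial = List (List ℕ)

-- The exponent of x_{i+1,j+1}.
exponent : Monomial → ℕ → ℕ → ℕ
exponent m i j = entry 0 (entry [] m i) j

-- Trailing zeros make different lists represent the same monomial.
infix 4 _≈ₘ_
_≈ₘ_ : Monomial → Monomial → Set
m ≈ₘ m′ = ∀ i j → exponent m i j ≡ exponent m′ i j

-- Row i, counted from 1, holds variables of degree i.
deg : Monomial → ℕ
deg m = weight 1 (map sum m)

record PowerSeries : Set where
  field
    coeff      : Monomial → ℚ
    coeff-cong : ∀ m m′ → m ≈ₘ m′ → coeff m ≡ coeff m′

open PowerSeries public

Padded : A → Rel A 0ℓ → Rel (List A) 0ℓ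
Padded z R xs ys = ∀ i → R (entry z xs i) (entry z ys i)

module _ {P : Pred A 0ℓ} {R : Rel A 0ℓ} {z : A}
         (Pz : P z) (resp : ∀ {a b} → R a b → P a → P b) where

  All-padded : ∀ {xs ys} → Padded z R xs ys → All P xs → All P ys
  All-padded {_}      {[]}     eq _        = []
  All-padded {[]}     {y ∷ ys} eq []       =
    resp (eq 0) Pz ∷ All-padded {[]} {ys} (eq ∘ suc) []
  All-padded {x ∷ xs} {y ∷ ys} eq (p ∷ ps) =
    resp (eq 0) p ∷ All-padded {xs} {ys} (eq ∘ suc) ps

AllExp : (ℕ → Set) → Monomial → Set
AllExp P = All (All P)

allExp-cong : {P : ℕ → Set} → P 0 →
              ∀ m m′ → m ≈ₘ m′ → AllExp P m ⇔ AllExp P m′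
allExp-cong {P} P0 m m′ eq = mk⇔ (to m m′ eq) (to m′ m (λ i j → sym (eq i j)))
  where
  to : ∀ m m′ → m ≈ₘ m′ → AllExp P m → AllExp P m′
  to m m′ = All-padded {R = Padded 0 _≡_} []
    (λ {as} {bs} → All-padded {R = _≡_} P0 (λ e → subst P e) {as} {bs}) {m} {m′}

entry-map : ∀ {z w} (f : A → B) → f z ≡ w → ∀ xs i →
            entry w (map f xs) i ≡ f (entry z xs i)
entry-map f fz []       i       = sym fz
entry-map f fz (x ∷ xs) zero    = refl
entry-map f fz (x ∷ xs) (suc i) = entry-map f fz xs i

sum-cong : ∀ xs ys → Padded 0 _≡_ xs ys → sum xs ≡ sum ys
sum-cong []       []       eq = refl
sum-cong []       (y ∷ ys) eq = cong₂ ℕ._+_ (eq 0) (sum-cong [] ys (eq ∘ suc))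
sum-cong (x ∷ xs) []       eq = cong₂ ℕ._+_ (eq 0) (sum-cong xs [] (eq ∘ suc))
sum-cong (x ∷ xs) (y ∷ ys) eq = cong₂ ℕ._+_ (eq 0) (sum-cong xs ys (eq ∘ suc))

weight-cong : ∀ k xs ys → Padded 0 _≡_ xs ys → weight k xs ≡ weight k ys
weight-cong k []       []       eq = refl
weight-cong k []       (y ∷ ys) eq =
  cong₂ ℕ._+_ (trans (sym (ℕ.*-zeroʳ k)) (cong (k ℕ.*_) (eq 0)))
    (weight-cong (suc k) [] ys (eq ∘ suc))
weight-cong k (x ∷ xs) []       eq =
  cong₂ ℕ._+_ (trans (cong (k ℕ.*_) (eq 0)) (ℕ.*-zeroʳ k))
    (weight-cong (suc k) xs [] (eq ∘ suc))
weight-cong k (x ∷ xs) (y ∷ ys) eq =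
  cong₂ ℕ._+_ (cong (k ℕ.*_) (eq 0)) (weight-cong (suc k) xs ys (eq ∘ suc))

deg-cong : ∀ m m′ → m ≈ₘ m′ → deg m ≡ deg m′
deg-cong m m′ eq = weight-cong 1 (map sum m) (map sum m′) λ i → begin
  entry 0 (map sum m) i   ≡⟨ entry-map sum refl m i ⟩
  sum (entry [] m i)      ≡⟨ sum-cong (entry [] m i) (entry [] m′ i) (eq i) ⟩
  sum (entry [] m′ i)     ≡⟨ entry-map sum refl m′ i ⟨
  entry 0 (map sum m′) i  ∎
  where open ≡-Reasoning

indicator : {P : Set} → Dec P → ℚ
indicator P? = if does P? then 1ℚ else 0ℚ

if-cong : {P Q : Set} (P? : Dec P) (Q? : Dec Q) → P ⇔ Q → {x y z : ℚ} → x ≡ y →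
          (if does P? then x else z) ≡ (if does Q? then y else z)
if-cong P? (yes q) e eq rewrite dec-true P? (Equivalence.from e q) = eq
if-cong P? (no ¬q) e eq rewrite dec-false P? (¬q ∘ Equivalence.to e) = refl

indicatorSeries : {P : Monomial → Set} → Decidable P →
                  (∀ m m′ → m ≈ₘ m′ → P m ⇔ P m′) → PowerSeries
indicatorSeries P? P-cong = record
  { coeff      = λ m → indicator (P? m)
  ; coeff-cong = λ m m′ eq → if-cong (P? m) (P? m′) (P-cong m m′ eq) refl
  }

deg≡-cong : ∀ d m m′ → m ≈ₘ m′ → (deg m ≡ d) ⇔ (deg m′ ≡ d)
deg≡-cong d m m′ eq =
  mk⇔ (trans (sym (deg-cong m m′ eq))) (trans (deg-cong m m′ eq))

H : ℕ → PowerSeries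
H d = indicatorSeries (λ m → deg m ℕ.≟ d) (deg≡-cong d)

SquareFree : Monomial → Set
SquareFree = AllExp (_≤ 1)

squareFree? : Decidable SquareFree
squareFree? = All.all? (All.all? (ℕ._≤? 1))

E⁺ : ℕ → PowerSeries
E⁺ d = indicatorSeries (λ m → (deg m ℕ.≟ d) ×-dec squareFree? m) λ m m′ eq →
  let open Equivalence
      e₁ = deg≡-cong d m m′ eq
      e₂ = allExp-cong z≤n m m′ eq
  in mk⇔ (λ (p , q) → to e₁ p , to e₂ q) (λ (p , q) → from e₁ p , from e₂ q)

one : PowerSeries
one = indicatorSeries {P = AllExp (_≡ 0)}
  (All.all? (All.all? (ℕ._≟ 0))) (allExp-cong refl)

root : ∀ r → .{{NonZero r}} → Monomial → Monomial
root r = map (map (_/ r))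

root-cong : ∀ r → .{{_ : NonZero r}} → ∀ m m′ →
            m ≈ₘ m′ → root r m ≈ₘ root r m′
root-cong r m m′ eq i j = begin
  exponent (root r m) i j   ≡⟨ exponent-root m ⟩
  exponent m i j / r        ≡⟨ cong (_/ r) (eq i j) ⟩
  exponent m′ i j / r       ≡⟨ exponent-root m′ ⟨
  exponent (root r m′) i j  ∎
  where
  open ≡-Reasoning
  exponent-root : ∀ m → exponent (root r m) i j ≡ exponent m i j / r
  exponent-root m = trans
    (cong (λ row → entry 0 row j) (entry-map (map (_/ r)) refl m i))
    (entry-map (_/ r) (0/n≡0 r) (entry [] m i) j)

-- Replace every x_{i,j} by x_{i,j}ʳ: the coefficient at m is that of the r-th
-- root of m if m is an r-th power, and 0 otherwise.
infix 9 _⟨_⟩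
_⟨_⟩ : PowerSeries → ∀ r → .{{NonZero r}} → PowerSeries
F ⟨ r ⟩ = record
  { coeff      = λ m → if does (power? m) then coeff F (root r m) else 0ℚ
  ; coeff-cong = λ m m′ eq → if-cong (power? m) (power? m′)
      (allExp-cong (r ∣0) m m′ eq)
      (coeff-cong F (root r m) (root r m′) (root-cong r m m′ eq))
  }
  where
  power? : Decidable (AllExp (r ∣_))
  power? = All.all? (All.all? (r ∣?_))

splitℕ : ℕ → List (ℕ × ℕ)
splitℕ e = map (λ k → k , e ∸ k) (upTo (suc e))

_∷₂_ : A × A → List A × List A → List A × List A
(a , b) ∷₂ (as , bs) = a ∷ as , b ∷ bs

splitList : (A → List (A × A)) → List A → List (List A × List A)
splitList split []       = ([] , []) ∷ []
splitList split (x ∷ xs) = cartesianProductWith _∷₂_ (split x) (splitList split xs)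

-- All pairs (m₁ , m₂) with m₁ m₂ = m.
factorizations : Monomial → List (Monomial × Monomial)
factorizations = splitList (splitList splitℕ)

module _ {R : Rel A 0ℓ} {z : A} {split : A → List (A × A)} where

  R₂ : Rel (A × A) 0ℓ
  R₂ (a , b) (a′ , b′) = R a a′ × R b b′

  Padded₂ : Rel (List A × List A) 0ℓ
  Padded₂ (as , bs) (as′ , bs′) = Padded z R as as′ × Padded z R bs bs′

  module _ (R-refl : ∀ {a} → R a a)
           (split-zero : split z ≡ (z , z) ∷ [])
           (split-cong : ∀ {a b} → R a b → Pointwise R₂ (split a) (split b))
    where

    consPadded : ∀ {a b as bs} → R a b → Padded z R as bs →
                 Padded z R (a ∷ as) (b ∷ bs)
    consPadded p ps zero    = p
    consPadded p ps (suc i) = ps i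

    splitList-cong : ∀ xs ys → Padded z R xs ys →
                     Pointwise Padded₂ (splitList split xs) (splitList split ys)
    splitList-cong [] [] eq = ((λ _ → R-refl) , (λ _ → R-refl)) ∷ []
    splitList-cong [] (y ∷ ys) eq =
      nils (subst (λ s → Pointwise R₂ s (split y)) split-zero (split-cong (eq 0)))
           (splitList-cong [] ys (eq ∘ suc))
      where
      consˡ : ∀ {b bs} → R z b → Padded z R [] bs → Padded z R [] (b ∷ bs)
      consˡ p ps zero    = p
      consˡ p ps (suc i) = ps i
      nils : ∀ {ss tt} → Pointwise R₂ ((z , z) ∷ []) ss →
             Pointwise Padded₂ (([] , []) ∷ []) tt →
             Pointwise Padded₂ (([] , []) ∷ []) (cartesianProductWith _∷₂_ ss tt)
      nils ((p , q) ∷ []) ((ps , qs) ∷ []) = (consˡ p ps , consˡ q qs) ∷ []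
    splitList-cong (x ∷ xs) [] eq =
      nils (subst (Pointwise R₂ (split x)) split-zero (split-cong (eq 0)))
           (splitList-cong xs [] (eq ∘ suc))
      where
      consʳ : ∀ {b bs} → R b z → Padded z R bs [] → Padded z R (b ∷ bs) []
      consʳ p ps zero    = p
      consʳ p ps (suc i) = ps i
      nils : ∀ {ss tt} → Pointwise R₂ ss ((z , z) ∷ []) →
             Pointwise Padded₂ tt (([] , []) ∷ []) →
             Pointwise Padded₂ (cartesianProductWith _∷₂_ ss tt) (([] , []) ∷ [])
      nils ((p , q) ∷ []) ((ps , qs) ∷ []) = (consʳ p ps , consʳ q qs) ∷ []
    splitList-cong (x ∷ xs) (y ∷ ys) eq =
      product (split-cong (eq 0)) (splitList-cong xs ys (eq ∘ suc))
      where
      heads : ∀ {s s′ tt tt′} → R₂ s s′ → Pointwise Padded₂ tt tt′ →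
              Pointwise Padded₂ (map (s ∷₂_) tt) (map (s′ ∷₂_) tt′)
      heads _       []               = []
      heads (p , q) ((ps , qs) ∷ rs) =
        (consPadded p ps , consPadded q qs) ∷ heads (p , q) rs
      product : ∀ {ss ss′ tt tt′} → Pointwise R₂ ss ss′ → Pointwise Padded₂ tt tt′ →
                Pointwise Padded₂ (cartesianProductWith _∷₂_ ss tt)
                                  (cartesianProductWith _∷₂_ ss′ tt′)
      product []       ts = []
      product (s ∷ ss) ts = Pw.++⁺ (heads s ts) (product ss ts)

factorizations-cong : ∀ m m′ → m ≈ₘ m′ →
  Pointwise (λ (a , b) (a′ , b′) → a ≈ₘ a′ × b ≈ₘ b′)
    (factorizations m) (factorizations m′)
factorizations-cong m m′ =
  splitList-cong {R = Padded 0 _≡_} {z = []} {split = splitList splitℕ}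
    (λ _ → refl) refl
    (λ {a} {b} → splitList-cong {R = _≡_} {z = 0} {split = splitℕ} refl refl
      (λ { refl → Pw.refl (refl , refl) }) a b)
    m m′

sum-map-cong : {R : Rel A 0ℓ} (f : A → ℚ) → (∀ {a b} → R a b → f a ≡ f b) →
               ∀ {xs ys} → Pointwise R xs ys → sumℚ (map f xs) ≡ sumℚ (map f ys)
sum-map-cong f f-cong []       = refl
sum-map-cong f f-cong (r ∷ rs) =
  cong₂ ℚ._+_ (f-cong r) (sum-map-cong f f-cong rs)

infixl 7 _·_
_·_ : PowerSeries → PowerSeries → PowerSeries
F · G = record
  { coeff      = λ m → sumℚ (map term (factorizations m))
  ; coeff-cong = λ m m′ eq → sum-map-cong term
      (λ {(a , b)} {(a′ , b′)} (p , q) →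
        cong₂ _*_ (coeff-cong F a a′ p) (coeff-cong G b b′ q))
      (factorizations-cong m m′ eq)
  }
  where
  term : Monomial × Monomial → ℚ
  term (m₁ , m₂) = coeff F m₁ * coeff G m₂

-- F_{dʳ} and F_τ for a family F = (F_d)_d.
blockSeries : (ℕ → PowerSeries) → Block → PowerSeries
blockSeries F (block d r) = F d ⟨ r ⟩

infix 9 _⟦_⟧
_⟦_⟧ : (ℕ → PowerSeries) → Typ n → PowerSeries
F ⟦ τ ⟧ = foldr _·_ one (map (blockSeries F) (blocks τ))

IsExpansion : (Typ n → PowerSeries) → PowerSeries → (Typ n → ℚ) → Set
IsExpansion {n} B G c =
  ∀ m → coeff G m ≡ ∑ (types n) (λ ρ → c ρ * coeff (B ρ) m)

-- Uniqueness of the expansion is part of the claim, so that "the" coefficient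
-- of B τ is meaningful without assuming that B is a basis.
IsCoefficient : (Typ n → PowerSeries) → Typ n → PowerSeries → ℚ → Set
IsCoefficient B τ G a = Σ (∃! _≗_ (IsExpansion B G)) λ (c , _) → c τ ≡ a

-- brick a has length a, doublebrick b has length 2b.
data Tile : Set where
  brick       : (a : ℕ) → .{{NonZero a}} → Tile
  doublebrick : (b : ℕ) → .{{NonZero b}} → Tile

tileLength : Tile → ℕ
tileLength (brick a)       = a
tileLength (doublebrick b) = 2 ℕ.* b

isDouble : Tile → Bool
isDouble (brick _)       = false
isDouble (doublebrick _) = true

-- Read from left to right, no brick comes after a doublebrick.
DoublesRight : List Tile → Set
DoublesRight = AllPairs (λ s t → T (isDouble s) → T (isDouble t))

IsRow : ℕ → List Tile → Set
IsRow l ts = sum (map tileLength ts) ≡ l × DoublesRight ts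

-- A row of l cells, cut into tiles listed from left to right.
Row : ℕ → Set
Row l = [ ts ∈ List Tile ∣ IsRow l ts ]

-- The block dʳ of σ stands for a row of d cells in the r-th tensor factor, so
-- the list of blocks of σ is the list of rows of the tensor diagram of σ.
DoublePolybrickTabloid : Typ n → Set
DoublePolybrickTabloid σ = All (Row ∘ degree) (blocks σ)

tileBlock : ∀ m → .{{NonZero m}} → Tile → Block
tileBlock m (brick a)       = block a m
tileBlock m (doublebrick b) = block b (2 ℕ.* m) {{ℕ.m*n≢0 2 m}}

content : {bs : List Block} → All (Row ∘ degree) bs → List Block
content T = concat (reduce (λ {(block _ m)} row → map (tileBlock m) (value row)) T)

rows : {bs : List Block} → All (Row ∘ degree) bs → List (List Tile)
rows T = reduce value T

#bricks #doublebricks : List Tile → ℕ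
#bricks       = length ∘ filterᵇ (not ∘ isDouble)
#doublebricks = length ∘ filterᵇ isDouble

PT-H-doub : Typ n → Typ n → Set
PT-H-doub σ τ = [ T ∈ DoublePolybrickTabloid σ ∣
                  content T ↭ blocks τ × All (λ ts → #bricks ts ≤ 1) (rows T) ]

ℓ₂ : (σ τ : Typ n) → PT-H-doub σ τ → ℕ
ℓ₂ σ τ T = sum (map #doublebricks (rows (value T)))

isRow? : ∀ l → Decidable (IsRow l)
isRow? l ts = (sum (map tileLength ts) ℕ.≟ l)
  ×-dec AllPairs.allPairs? (λ s t → T? (isDouble s) →-dec T? (isDouble t)) ts

tilesUpTo : ℕ → List Tile
tilesUpTo l = map (λ a → brick (suc a)) (upTo l)
           ++ map (λ b → doublebrick (suc b)) (upTo l)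

tilesUpTo-unique : ∀ l → Unique (tilesUpTo l)
tilesUpTo-unique l = ++⁺ (map⁺ (λ { refl → refl }) (upTo⁺ l))
                         (map⁺ (λ { refl → refl }) (upTo⁺ l)) disjoint
  where
  disjoint : ∀ {t} → t ∈ map (λ a → brick (suc a)) (upTo l) ×
                     t ∈ map (λ b → doublebrick (suc b)) (upTo l) → _
  disjoint (p , q) with _ , _ , refl ← ∈-map⁻ _ p | _ , _ , () ← ∈-map⁻ _ q

∈-tilesUpTo : ∀ {l} t → tileLength t ≤ l → t ∈ tilesUpTo l
∈-tilesUpTo (brick (suc a))       le = ∈-++⁺ˡ (∈-map⁺ _ (∈-upTo⁺ le))
∈-tilesUpTo (doublebrick (suc b)) le = ∈-++⁺ʳ _ (∈-map⁺ _ (∈-upTo⁺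
  (ℕ.≤-trans (ℕ.m≤m+n (suc b) _) le)))

tileLength-nonZero : ∀ t → NonZero (tileLength t)
tileLength-nonZero (brick (suc _))       = _
tileLength-nonZero (doublebrick (suc _)) = _

rowEnumeration : ∀ l → Enumeration (Row l)
rowEnumeration l = refinement (isRow? l) (listsUpTo l (tilesUpTo l))
  (listsUpTo-unique l (tilesUpTo-unique l))
  λ { ts (refl , _) → ∈-listsUpTo
        (All.map (λ {t} → ∈-tilesUpTo t) (each≤total tileLength ts))
        (length≤total tileLength ts (All.universal tileLength-nonZero ts)) }

_≟ᵇ_ : DecidableEquality Block
block d r ≟ᵇ block d′ r′ =
  map′ (λ { (refl , refl) → refl }) (λ { refl → refl , refl })
    ((d ℕ.≟ d′) ×-dec (r ℕ.≟ r′))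

open import Data.List.Membership.DecPropositional _≟ᵇ_ using (_∈?_)

_↭?_ : (xs ys : List Block) → Dec (xs ↭ ys)
[] ↭? []       = yes ↭-refl
[] ↭? (y ∷ ys) = no λ p → contradiction (↭-empty-inv (↭-sym p)) λ ()
(x ∷ xs) ↭? ys with x ∈? ys
... | no  x∉ = no λ p → x∉ (∈-resp-↭ p (here refl))
... | yes x∈ with as , bs , refl ← ∈-∃++ x∈ =
  map′ (λ p → ↭-trans (prep x p) (↭-sym (shift x as bs)))
       (λ p → drop-∷ (↭-trans p (shift x as bs)))
       (xs ↭? (as ++ bs))

tabloids : (σ τ : Typ n) → Enumeration (PT-H-doub σ τ)
tabloids σ τ = refinement
  (λ T → (content T ↭? blocks τ) ×-dec All.all? (λ ts → #bricks ts ℕ.≤? 1) (rows T))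
  All-rows.elements All-rows.unique (λ T _ → All-rows.complete T)
  where
  module All-rows = Enumeration (allEnumeration (rowEnumeration ∘ degree) (blocks σ))

module Submission where

-- Every monomial is uniquely a square-free monomial times a square, so
-- Σ_b E⁺_{d−2b} H_{b²} = H_d, and likewise after x_{i,j} ↦ x_{i,j}ʳ.  Solving for
-- E⁺_d peels off a doublebrick, with sign −1, at the right end of a row of length
-- d; what is left in the end is H_d or 1, the row with one brick or none.
-- Multiplying over the rows of σ gives the expansion.
--
-- For its uniqueness, order the monomials by total exponent: the lowest part of
-- H_{dʳ} is the power sum Σ_j x_{d,j}ʳ, so that of H_τ is a product of power sums.
-- Merging two of its variables makes their number drop, hence the matrix of
-- the coefficients of the H_τ at the monomials Π x_{d,j}ʳ with one variable per
-- block dʳ of ρ is triangular, with positive diagonal.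

open import Defs
open import Algebra.Bundles using (CommutativeMonoid; CommutativeRing)
open import Data.Bool.Base using (if_then_else_)
open import Data.Fin.Base as Fin using (toℕ; fromℕ<)
import Data.Fin.Properties as Fin
open import Data.Irrelevant using ([_])
open import Data.List.Base
  using (List; []; _∷_; _++_; _∷ʳ_; map; concat; length; foldr; upTo; applyUpTo;
         cartesianProductWith; filter; InitLast; initLast; _∷ʳ′_)
open import Data.List.Membership.Propositional using (_∈_)
open import Data.List.Membership.Propositional.Properties
  using (∈-map⁺; ∈-map⁻; ∈-upTo⁺; ∈-upTo⁻; ∈-cartesianProductWith⁺;
         ∈-cartesianProductWith⁻; ∈-concat⁺′; ∈-concat⁻′; ∈-filter⁺; ∈-filter⁻)
open import Data.List.Membership.Propositional.Properties.WithK
  using (unique∧set⇒bag)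
import Data.List.Properties as List
open import Data.List.Relation.Binary.BagAndSetEquality using (∼bag⇒↭)
open import Data.List.Relation.Binary.Permutation.Propositional as Perm
  using (_↭_; ↭⇒↭ₛ)
open import Data.List.Relation.Binary.Permutation.Propositional.Properties
  using (shift; All-resp-↭; map⁺; filter-↭; ++⁺ʳ; ++⁺ˡ; ↭-length)
open import Data.List.Relation.Binary.Pointwise using (Pointwise-≡⇒≡)
open import Data.List.Relation.Unary.All as All using (All; []; _∷_)
import Data.List.Relation.Unary.All.Properties as All
open import Data.List.Relation.Unary.AllPairs as AllPairs
  using (AllPairs; []; _∷_)
import Data.List.Relation.Unary.AllPairs.Properties as AllPairs
open import Data.List.Relation.Unary.Any using (here; there)
open import Data.List.Relation.Unary.Linked using ([])
open import Data.List.Relation.Unary.Sorted.TotalOrder.Properties using (↗↭↗⇒≋)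
open import Data.List.Relation.Unary.Unique.Propositional using (Unique)
import Data.List.Relation.Unary.Unique.Propositional.Properties as Unique
open import Data.Nat.Base as ℕ
  using (ℕ; zero; suc; _∸_; _≤_; _<_; _/_; _%_; z≤n; s≤s; NonZero)
open import Data.Nat.Divisibility
  using (_∣_; _∣?_; divides; _∣0; m∣m*n; ∣⇒≤)
open import Data.Nat.DivMod
  using (m≡m%n+[m/n]*n; m%n<n; m/n*n≤m; m*n/n≡m; /-monoˡ-≤; m*[n/m]≡n)
open import Data.Nat.Induction using (<-wellFounded)
open import Data.Nat.ListAction using (sum)
open import Data.Nat.ListAction.Properties using (sum-++; sum-↭)
import Data.Nat.Properties as ℕ
import Data.Nat.Tactic.RingSolver as ℕ-Ring
open import Data.Product using (_×_; _,_; ∃; ∃₂; proj₁; proj₂)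
open import Data.Rational.Base as ℚ
  using (ℚ; 0ℚ; 1ℚ; _+_; _*_; -_; NonNegative; Positive)
import Data.Rational.Properties as ℚ
open import Data.Refinement using (value; _,_)
open import Data.Refinement.Properties using (value-injective)
open import Data.Sum.Base using (_⊎_; inj₁; inj₂)
open import Data.Unit.Base using (tt)
open import Data.Vec.Base as Vec using (Vec; []; _∷_; toList; replicate)
open import Function.Base using (_∘_)
open import Function.Bundles using (_⇔_; mk⇔; Equivalence)
open import Induction.WellFounded using (Acc; acc)
open import Relation.Binary.Bundles using (DecTotalOrder)
import Relation.Binary.Construct.Flip.EqAndOrd as Flip
open import Relation.Binary.PropositionalEquality
open import Relation.Nullary.Decidable
  using (Dec; yes; no; does; _×-dec_; dec-true; dec-false; ¬?)
open import Relation.Nullary.Negation using (contradiction; ¬_)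
open import Relation.Unary using (Pred; Decidable)

open import Algebra.Properties.Group ℚ.+-0-group using ()
  renaming (∙-cancelˡ to +-cancelˡ; ∙-cancelʳ to +-cancelʳ)
open import Algebra.Properties.CommutativeSemigroup
  (CommutativeMonoid.commutativeSemigroup ℚ.+-0-commutativeMonoid) using ()
  renaming (interchange to +-interchange)
open import Algebra.Properties.CommutativeSemigroup
  (CommutativeMonoid.commutativeSemigroup ℚ.*-1-commutativeMonoid) using ()
  renaming (interchange to *-interchange)
open import Algebra.Properties.Semiring.Exp
  (CommutativeRing.semiring ℚ.+-*-commutativeRing) using (^-homo-*)

-- The convolution identity mixes a condition on single exponents (divisibility, square-freeness)
-- with one on degrees. Coefficients are therefore written as a product of two indicators. Summing
-- over b settles the degrees, because 2r divides the degree of a 2r-th power; what remains factors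
-- over the exponents, so an identity about one natural number suffices.
--
-- The sum in the theorem fixes the content, which does not factor over rows. So the signed sum of H
-- at the content of T is first taken over all tabloids T of shape σ, where it is a product of row
-- sums, and only then grouped by content. The grouping rests on a bijection between `Typ n` and the
-- multisets of blocks of positive degree and weight n.
--
-- Different lists of exponents can denote the same monomial, but every identity of series is proved
-- at every list, so representatives never have to be normalized.

≥-decTotalOrder : DecTotalOrder _ _ _
≥-decTotalOrder = Flip.decTotalOrder ℕ.≤-decTotalOrder

open import Data.List.Sort.InsertionSort.Base ≥-decTotalOrder using (insert)
open import Data.List.Sort.InsertionSort.Properties ≥-decTotalOrder
  using (insert-↭; insert-↗)

private
  variable
    A B : Set

-- Finite sums and indicators

sumOver : List A → (A → ℚ) → ℚ
sumOver xs f = sumℚ (map f xs)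

syntax sumOver xs (λ x → e) = ∑[ x ∈ xs ] e

sumOver-cong-∈ : ∀ (xs : List A) {f g : A → ℚ} →
                 (∀ x → x ∈ xs → f x ≡ g x) → sumOver xs f ≡ sumOver xs g
sumOver-cong-∈ []       eq = refl
sumOver-cong-∈ (x ∷ xs) eq =
  cong₂ _+_ (eq x (here refl)) (sumOver-cong-∈ xs (λ y y∈ → eq y (there y∈)))

sumOver-cong : ∀ (xs : List A) {f g : A → ℚ} →
               (∀ x → f x ≡ g x) → sumOver xs f ≡ sumOver xs g
sumOver-cong xs eq = sumOver-cong-∈ xs (λ x _ → eq x)

sumOver-zero : ∀ (xs : List A) → ∑[ x ∈ xs ] 0ℚ ≡ 0ℚ
sumOver-zero []       = refl
sumOver-zero (x ∷ xs) = trans (ℚ.+-identityˡ _) (sumOver-zero xs)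

sumOver-+ : ∀ (xs : List A) (f g : A → ℚ) →
            ∑[ x ∈ xs ] (f x + g x) ≡ sumOver xs f + sumOver xs g
sumOver-+ []       f g = refl
sumOver-+ (x ∷ xs) f g =
  trans (cong (f x + g x +_) (sumOver-+ xs f g)) (+-interchange (f x) _ _ _)

sumOver-*ˡ : ∀ (xs : List A) c (f : A → ℚ) → ∑[ x ∈ xs ] (c * f x) ≡ c * sumOver xs f
sumOver-*ˡ []       c f = sym (ℚ.*-zeroʳ c)
sumOver-*ˡ (x ∷ xs) c f =
  trans (cong (c * f x +_) (sumOver-*ˡ xs c f)) (sym (ℚ.*-distribˡ-+ c (f x) _))

sumOver-*ʳ : ∀ (xs : List A) (f : A → ℚ) c → ∑[ x ∈ xs ] (f x * c) ≡ sumOver xs f * c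
sumOver-*ʳ xs f c = trans (sumOver-cong xs (λ x → ℚ.*-comm (f x) c))
  (trans (sumOver-*ˡ xs c f) (ℚ.*-comm c _))

sumOver-swap : ∀ (xs : List A) (ys : List B) (f : A → B → ℚ) →
               ∑[ x ∈ xs ] ∑[ y ∈ ys ] f x y ≡ ∑[ y ∈ ys ] ∑[ x ∈ xs ] f x y
sumOver-swap []       ys f = sym (sumOver-zero ys)
sumOver-swap (x ∷ xs) ys f = trans (cong (sumOver ys (f x) +_) (sumOver-swap xs ys f))
  (sym (sumOver-+ ys (f x) (λ y → ∑[ x ∈ xs ] f x y)))

sumOver-++ : ∀ (xs ys : List A) (f : A → ℚ) →
             sumOver (xs ++ ys) f ≡ sumOver xs f + sumOver ys f
sumOver-++ []       ys f = sym (ℚ.+-identityˡ _)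
sumOver-++ (x ∷ xs) ys f =
  trans (cong (f x +_) (sumOver-++ xs ys f)) (sym (ℚ.+-assoc (f x) _ _))

sumOver-map : ∀ (h : A → B) xs (f : B → ℚ) → sumOver (map h xs) f ≡ sumOver xs (f ∘ h)
sumOver-map h xs f = cong sumℚ (sym (List.map-∘ xs))

sumOver-concatMap : ∀ (h : A → List B) xs (f : B → ℚ) →
                    sumOver (concat (map h xs)) f ≡ ∑[ x ∈ xs ] sumOver (h x) f
sumOver-concatMap h []       f = refl
sumOver-concatMap h (x ∷ xs) f =
  trans (sumOver-++ (h x) _ f) (cong (sumOver (h x) f +_) (sumOver-concatMap h xs f))

sumOver-product : ∀ {C : Set} (h : A → B → C) xs ys (f : C → ℚ) →
  sumOver (cartesianProductWith h xs ys) f ≡ ∑[ x ∈ xs ] ∑[ y ∈ ys ] f (h x y)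
sumOver-product h []       ys f = refl
sumOver-product h (x ∷ xs) ys f = trans (sumOver-++ (map (h x) ys) _ f)
  (cong₂ _+_ (sumOver-map (h x) ys f) (sumOver-product h xs ys f))

sumOver-↭ : ∀ {xs ys : List A} (f : A → ℚ) → xs ↭ ys → sumOver xs f ≡ sumOver ys f
sumOver-↭ f Perm.refl          = refl
sumOver-↭ f (Perm.prep x p)    = cong (f x +_) (sumOver-↭ f p)
sumOver-↭ f (Perm.swap {xs} {ys} x y p) = begin
  f x + (f y + sumOver xs f)  ≡⟨ cong (λ s → f x + (f y + s)) (sumOver-↭ f p) ⟩
  f x + (f y + sumOver ys f)  ≡⟨ ℚ.+-assoc (f x) (f y) _ ⟨
  f x + f y + sumOver ys f    ≡⟨ cong (_+ _) (ℚ.+-comm (f x) (f y)) ⟩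
  f y + f x + sumOver ys f    ≡⟨ ℚ.+-assoc (f y) (f x) _ ⟩
  f y + (f x + sumOver ys f)  ∎
  where open ≡-Reasoning
sumOver-↭ f (Perm.trans p q)   = trans (sumOver-↭ f p) (sumOver-↭ f q)

-- One step of solving a triangular system: `x` is the only unknown not yet settled in the equation,
-- and it occurs in it once.
sumOver-cancel : ∀ {xs : List A} {x} {f g : A → ℚ} → Unique xs → x ∈ xs →
                 (∀ y → y ≢ x → f y ≡ g y) → sumOver xs f ≡ sumOver xs g → f x ≡ g x
sumOver-cancel {xs = x ∷ xs} {f = f} {g} (x∉ ∷ _) (here refl) eq sums =
  +-cancelʳ (sumOver xs f) (f x) (g x) (trans sums (cong (g x +_) (sym
    (sumOver-cong-∈ xs (λ y y∈ → eq y (≢-sym (All.lookup x∉ y∈)))))))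
sumOver-cancel {xs = y ∷ xs} {x} {f} {g} (y∉ ∷ xs!) (there x∈) eq sums =
  sumOver-cancel xs! x∈ eq (+-cancelˡ (f y) _ _
    (trans sums (cong (_+ sumOver xs g) (sym (eq y (All.lookup y∉ x∈))))))

indicator-yes : ∀ {P : Set} (P? : Dec P) → P → indicator P? ≡ 1ℚ
indicator-yes P? p rewrite dec-true P? p = refl

indicator-no : ∀ {P : Set} (P? : Dec P) → ¬ P → indicator P? ≡ 0ℚ
indicator-no P? ¬p rewrite dec-false P? ¬p = refl

indicator-cong : ∀ {P Q : Set} (P? : Dec P) (Q? : Dec Q) → P ⇔ Q →
                 indicator P? ≡ indicator Q?
indicator-cong P? Q? e = if-cong P? Q? e refl

indicator-× : ∀ {P Q : Set} (P? : Dec P) (Q? : Dec Q) →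
              indicator (P? ×-dec Q?) ≡ indicator P? * indicator Q?
indicator-× (yes _) Q? = sym (ℚ.*-identityˡ (indicator Q?))
indicator-× (no _)  Q? = sym (ℚ.*-zeroˡ (indicator Q?))

indicator-*-cong : ∀ {P : Set} (P? : Dec P) {x y : ℚ} → (P → x ≡ y) →
                   indicator P? * x ≡ indicator P? * y
indicator-*-cong (yes p) eq = cong (1ℚ *_) (eq p)
indicator-*-cong (no _) {x} {y} eq = trans (ℚ.*-zeroˡ x) (sym (ℚ.*-zeroˡ y))

indicator-if : ∀ {P : Set} (P? : Dec P) (x : ℚ) →
               (if does P? then x else 0ℚ) ≡ indicator P? * x
indicator-if (yes _) x = sym (ℚ.*-identityˡ x)
indicator-if (no _)  x = sym (ℚ.*-zeroˡ x)

-- This is how unique decompositions enter sums: `xs` has exactly one witness of `P` if `Q` holds,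
-- and none otherwise.
sumOver-indicator : ∀ {P : A → Set} {Q : Set} (P? : Decidable P) (Q? : Dec Q)
  {xs : List A} → Unique xs →
  (∀ {x y} → x ∈ xs → y ∈ xs → P x → P y → x ≡ y) →
  (Q → ∃ λ x → x ∈ xs × P x) → (∀ {x} → x ∈ xs → P x → Q) →
  ∑[ x ∈ xs ] indicator (P? x) ≡ indicator Q?
sumOver-indicator P? Q? {[]} _ _ find _ =
  sym (indicator-no Q? λ q → contradiction (proj₁ (proj₂ (find q))) λ ())
sumOver-indicator P? Q? {x ∷ xs} (x∉ ∷ xs!) same find imp with P? x
... | yes p = trans (trans (cong (1ℚ +_) (trans
        (sumOver-cong-∈ xs λ y y∈ → indicator-no (P? y)
          λ q → All.lookup x∉ y∈ (same (here refl) (there y∈) p q))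
        (sumOver-zero xs))) (ℚ.+-identityʳ 1ℚ))
      (sym (indicator-yes Q? (imp (here refl) p)))
... | no ¬p = trans (ℚ.+-identityˡ _)
      (sumOver-indicator P? Q? xs! (λ y∈ z∈ → same (there y∈) (there z∈)) find′ (imp ∘ there))
  where
  find′ : _ → _
  find′ q with find q
  ... | y , here refl , py = contradiction py ¬p
  ... | y , there y∈  , py = y , y∈ , py

sumOver-refine : ∀ {P : Pred A _} (P? : Decidable P) xs (f : A → ℚ) →
  ∑[ r ∈ refine P? xs ] f (value r) ≡ ∑[ x ∈ xs ] (indicator (P? x) * f x)
sumOver-refine P? []       f = refl
sumOver-refine P? (x ∷ xs) f with P? x
... | yes _ = cong₂ _+_ (sym (ℚ.*-identityˡ (f x))) (sumOver-refine P? xs f)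
... | no _  = trans (sumOver-refine P? xs f)
  (sym (trans (cong (_+ _) (ℚ.*-zeroˡ (f x))) (ℚ.+-identityˡ _)))

-- Splitting as a coproduct

splitSum : (A → List (A × A)) → A → (A → A → ℚ) → ℚ
splitSum split a F = ∑[ p ∈ split a ] F (proj₁ p) (proj₂ p)

splitSum-cong : ∀ (split : A → List (A × A)) a {F G : A → A → ℚ} →
                (∀ x y → F x y ≡ G x y) → splitSum split a F ≡ splitSum split a G
splitSum-cong split a eq = sumOver-cong (split a) (λ p → eq (proj₁ p) (proj₂ p))

-- Multiplication of series is convolution with respect to the coproduct `split`, so its
-- commutativity and associativity are dual to these two laws. In this form they pass from exponents
-- to rows and from rows to monomials by one and the same lemma.
record IsCocommutative (split : A → List (A × A)) : Set where
  field
    comm  : ∀ a F → splitSum split a F ≡ splitSum split a (λ x y → F y x)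
    assoc : ∀ a (F : A → A → A → ℚ) →
      splitSum split a (λ x z → splitSum split x (λ u v → F u v z)) ≡
      splitSum split a (λ u z → splitSum split z (λ v w → F u v w))

splitSum-∷ : ∀ (split : A → List (A × A)) x xs F →
  splitSum (splitList split) (x ∷ xs) F ≡
  splitSum split x (λ a b → splitSum (splitList split) xs (λ as bs → F (a ∷ as) (b ∷ bs)))
splitSum-∷ split x xs F =
  sumOver-product _∷₂_ (split x) (splitList split xs) (λ p → F (proj₁ p) (proj₂ p))

splitSum-swap : ∀ (split₁ : A → List (A × A)) (split₂ : B → List (B × B)) a b
  (F : A → A → B → B → ℚ) →
  splitSum split₁ a (λ x y → splitSum split₂ b (F x y)) ≡
  splitSum split₂ b (λ u v → splitSum split₁ a (λ x y → F x y u v))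
splitSum-swap split₁ split₂ a b F = sumOver-swap (split₁ a) (split₂ b) _

-- The splittings of head and tail are independent, so their sums can be interchanged; the law for
-- `split` then applies to the head and the induction to the tail.
splitList-isCocommutative : ∀ {split : A → List (A × A)} →
  IsCocommutative split → IsCocommutative (splitList split)
splitList-isCocommutative {A} {split} split-isCocommutative =
  record { comm = comms ; assoc = assocs }
  where
  open IsCocommutative split-isCocommutative
  open ≡-Reasoning
  S  = splitSum split
  S* = splitSum (splitList split)

  comms : ∀ xs F → S* xs F ≡ S* xs (λ as bs → F bs as)
  comms []       F = refl
  comms (x ∷ xs) F = begin
    S* (x ∷ xs) F
      ≡⟨ splitSum-∷ split x xs F ⟩
    S x (λ a b → S* xs λ as bs → F (a ∷ as) (b ∷ bs))
      ≡⟨ splitSum-cong split x (λ a b → comms xs _) ⟩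
    S x (λ a b → S* xs λ as bs → F (a ∷ bs) (b ∷ as))
      ≡⟨ comm x _ ⟩
    S x (λ a b → S* xs λ as bs → F (b ∷ bs) (a ∷ as))
      ≡⟨ splitSum-∷ split x xs _ ⟨
    S* (x ∷ xs) (λ as bs → F bs as) ∎

  assocs : ∀ xs (F : List A → List A → List A → ℚ) →
    S* xs (λ x z → S* x (λ u v → F u v z)) ≡ S* xs (λ u z → S* z (λ v w → F u v w))
  assocs []       F = refl
  assocs (x ∷ xs) F = begin
    S* (x ∷ xs) (λ ys zs → S* ys (λ us vs → F us vs zs))
      ≡⟨ splitSum-∷ split x xs _ ⟩
    S x (λ y z → S* xs λ ys zs → S* (y ∷ ys) (λ us vs → F us vs (z ∷ zs)))
      ≡⟨ splitSum-cong split x (λ y z → splitSum-cong (splitList split) xs (λ ys zs →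
           splitSum-∷ split y ys _)) ⟩
    S x (λ y z → S* xs λ ys zs → S y λ u v → S* ys λ us vs →
      F (u ∷ us) (v ∷ vs) (z ∷ zs))
      ≡⟨ splitSum-cong split x (λ y z → splitSum-swap (splitList split) split xs y _) ⟩
    S x (λ y z → S y λ u v → S* xs λ ys zs → S* ys λ us vs →
      F (u ∷ us) (v ∷ vs) (z ∷ zs))
      ≡⟨ assoc x _ ⟩
    S x (λ u z → S z λ v w → S* xs λ ys zs → S* ys λ us vs →
      F (u ∷ us) (v ∷ vs) (w ∷ zs))
      ≡⟨ splitSum-cong split x (λ u z → splitSum-cong split z (λ v w → assocs xs _)) ⟩
    S x (λ u z → S z λ v w → S* xs λ us zs → S* zs λ vs ws →
      F (u ∷ us) (v ∷ vs) (w ∷ ws))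
      ≡⟨ splitSum-cong split x (λ u z → splitSum-swap split (splitList split) z xs _) ⟩
    S x (λ u z → S* xs λ us zs → S z λ v w → S* zs λ vs ws →
      F (u ∷ us) (v ∷ vs) (w ∷ ws))
      ≡⟨ splitSum-cong split x (λ u z → splitSum-cong (splitList split) xs (λ us zs →
           splitSum-∷ split z zs _)) ⟨
    S x (λ u z → S* xs λ us zs → S* (z ∷ zs) (λ vs ws → F (u ∷ us) vs ws))
      ≡⟨ splitSum-∷ split x xs _ ⟨
    S* (x ∷ xs) (λ us zs → S* zs (λ vs ws → F us vs ws)) ∎

splitSum-suc : ∀ e F → splitSum splitℕ (suc e) F ≡
               F 0 (suc e) + splitSum splitℕ e (λ x y → F (suc x) y)
splitSum-suc e F = cong (F 0 (suc e) +_) (begin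
  sumOver (map (λ k → k , suc e ∸ k) (applyUpTo suc (suc e))) F′
    ≡⟨ cong (λ ks → sumOver (map (λ k → k , suc e ∸ k) ks) F′) (List.map-upTo suc (suc e)) ⟨
  sumOver (map (λ k → k , suc e ∸ k) (map suc (upTo (suc e)))) F′
    ≡⟨ cong (λ ks → sumOver ks F′) (List.map-∘ (upTo (suc e))) ⟨
  sumOver (map (λ k → suc k , e ∸ k) (upTo (suc e))) F′
    ≡⟨ sumOver-map _ (upTo (suc e)) F′ ⟩
  ∑[ k ∈ upTo (suc e) ] F (suc k) (e ∸ k)
    ≡⟨ sumOver-map (λ k → k , e ∸ k) (upTo (suc e)) F″ ⟨
  splitSum splitℕ e (λ x y → F (suc x) y) ∎)
  where
  open ≡-Reasoning
  F′ : ℕ × ℕ → ℚ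
  F′ p = F (proj₁ p) (proj₂ p)
  F″ : ℕ × ℕ → ℚ
  F″ p = F (suc (proj₁ p)) (proj₂ p)

splitSum-sucʳ : ∀ e F → splitSum splitℕ (suc e) F ≡
                splitSum splitℕ e (λ x y → F x (suc y)) + F (suc e) 0
splitSum-sucʳ zero    F = sym (trans (ℚ.+-assoc (F 0 1) 0ℚ (F 1 0))
  (cong (F 0 1 +_) (ℚ.+-comm 0ℚ (F 1 0))))
splitSum-sucʳ (suc e) F = begin
  splitSum splitℕ (suc (suc e)) F
    ≡⟨ splitSum-suc (suc e) F ⟩
  F 0 (suc (suc e)) + splitSum splitℕ (suc e) (λ x y → F (suc x) y)
    ≡⟨ cong (F 0 (suc (suc e)) +_) (splitSum-sucʳ e (λ x y → F (suc x) y)) ⟩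
  F 0 (suc (suc e)) + (splitSum splitℕ e (λ x y → F (suc x) (suc y)) + F (suc (suc e)) 0)
    ≡⟨ ℚ.+-assoc (F 0 (suc (suc e)))
         (splitSum splitℕ e (λ x y → F (suc x) (suc y))) (F (suc (suc e)) 0) ⟨
  F 0 (suc (suc e)) + splitSum splitℕ e (λ x y → F (suc x) (suc y)) + F (suc (suc e)) 0
    ≡⟨ cong (_+ F (suc (suc e)) 0) (splitSum-suc e (λ x y → F x (suc y))) ⟨
  splitSum splitℕ (suc e) (λ x y → F x (suc y)) + F (suc (suc e)) 0 ∎
  where open ≡-Reasoning

splitℕ-isCocommutative : IsCocommutative splitℕ
splitℕ-isCocommutative = record { comm = comm ; assoc = assoc }
  where
  open ≡-Reasoning
  S = splitSum splitℕ

  comm : ∀ e F → S e F ≡ S e (λ x y → F y x)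
  comm zero    F = refl
  comm (suc e) F = begin
    S (suc e) F                                    ≡⟨ splitSum-suc e F ⟩
    F 0 (suc e) + S e (λ x y → F (suc x) y)        ≡⟨ cong (F 0 (suc e) +_) (comm e (λ x → F (suc x))) ⟩
    F 0 (suc e) + S e (λ x y → F (suc y) x)        ≡⟨ ℚ.+-comm (F 0 (suc e)) _ ⟩
    S e (λ x y → F (suc y) x) + F 0 (suc e)        ≡⟨ splitSum-sucʳ e (λ x y → F y x) ⟨
    S (suc e) (λ x y → F y x)                      ∎

  assoc : ∀ e (F : ℕ → ℕ → ℕ → ℚ) →
          S e (λ x z → S x (λ u v → F u v z)) ≡ S e (λ u z → S z (λ v w → F u v w))
  assoc zero    F = refl
  assoc (suc e) F = begin
    S (suc e) (λ x z → S x (λ u v → F u v z))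
      ≡⟨ splitSum-suc e (λ x z → S x (λ u v → F u v z)) ⟩
    S 0 (λ u v → F u v (suc e)) + S e (λ x z → S (suc x) (λ u v → F u v z))
      ≡⟨ cong₂ _+_ (ℚ.+-identityʳ (F 0 0 (suc e)))
           (splitSum-cong splitℕ e (λ x z → splitSum-suc x (λ u v → F u v z))) ⟩
    -- The triples with u = 0 are separated from those with u > 0: the former recombine to
    -- `S (suc e) (F 0)`, the latter fall to the induction.
    F 0 0 (suc e) + S e (λ x z → F 0 (suc x) z + S x (λ u v → F (suc u) v z))
      ≡⟨ cong (F 0 0 (suc e) +_) (sumOver-+ (splitℕ e)
           (λ p → F 0 (suc (proj₁ p)) (proj₂ p))
           (λ p → S (proj₁ p) (λ u v → F (suc u) v (proj₂ p)))) ⟩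
    F 0 0 (suc e) + (S e (λ x z → F 0 (suc x) z) + S e (λ x z → S x (λ u v → F (suc u) v z)))
      ≡⟨ ℚ.+-assoc (F 0 0 (suc e)) _ _ ⟨
    F 0 0 (suc e) + S e (λ x z → F 0 (suc x) z) + S e (λ x z → S x (λ u v → F (suc u) v z))
      ≡⟨ cong₂ _+_ (sym (splitSum-suc e (F 0))) (assoc e (λ u → F (suc u))) ⟩
    S (suc e) (F 0) + S e (λ u z → S z (λ v w → F (suc u) v w))
      ≡⟨ splitSum-suc e (λ u z → S z (F u)) ⟨
    S (suc e) (λ u z → S z (λ v w → F u v w)) ∎

factorizations-isCocommutative : IsCocommutative factorizations
factorizations-isCocommutative =
  splitList-isCocommutative (splitList-isCocommutative splitℕ-isCocommutative)

-- The inductive counterpart of membership in `splitList`: additivity of degrees and of total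
-- exponents is proved by recursion on it.
data ListSplit (R : A → A → A → Set) : List A → List A → List A → Set where
  []  : ListSplit R [] [] []
  _∷_ : ∀ {a b x as bs xs} → R a b x → ListSplit R as bs xs →
        ListSplit R (a ∷ as) (b ∷ bs) (x ∷ xs)

module _ {split : A → List (A × A)} {R : A → A → A → Set} where

  splitList⁻ : (∀ {a b x} → (a , b) ∈ split x → R a b x) →
               ∀ {as bs xs} → (as , bs) ∈ splitList split xs → ListSplit R as bs xs
  splitList⁻ split⁻ {xs = []}     (here refl) = []
  splitList⁻ split⁻ {xs = x ∷ xs} p∈
    with (a , b) , (as , bs) , p∈₁ , p∈₂ , refl ←
      ∈-cartesianProductWith⁻ _∷₂_ (split x) (splitList split xs) p∈
    = split⁻ p∈₁ ∷ splitList⁻ split⁻ p∈₂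

  splitList⁺ : (∀ {a b x} → R a b x → (a , b) ∈ split x) →
               ∀ {as bs xs} → ListSplit R as bs xs → (as , bs) ∈ splitList split xs
  splitList⁺ split⁺ []       = here refl
  splitList⁺ split⁺ (r ∷ rs) =
    ∈-cartesianProductWith⁺ _∷₂_ (split⁺ r) (splitList⁺ split⁺ rs)

RowSplit : List ℕ → List ℕ → List ℕ → Set
RowSplit = ListSplit (λ a b e → a ℕ.+ b ≡ e)

Factors : Monomial → Monomial → Monomial → Set
Factors = ListSplit RowSplit

∈-splitℕ⁻ : ∀ {a b e} → (a , b) ∈ splitℕ e → a ℕ.+ b ≡ e
∈-splitℕ⁻ {e = e} p∈ with k , k∈ , refl ← ∈-map⁻ _ p∈ =
  ℕ.m+[n∸m]≡n (ℕ.s≤s⁻¹ (∈-upTo⁻ k∈))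

∈-splitℕ⁺ : ∀ {a b e} → a ℕ.+ b ≡ e → (a , b) ∈ splitℕ e
∈-splitℕ⁺ {a} {b} refl = subst (λ z → (a , z) ∈ splitℕ (a ℕ.+ b)) (ℕ.m+n∸m≡n a b)
  (∈-map⁺ (λ k → k , (a ℕ.+ b) ∸ k) (∈-upTo⁺ (ℕ.s≤s (ℕ.m≤m+n a b))))

∈-factorizations⁻ : ∀ {x y m} → (x , y) ∈ factorizations m → Factors x y m
∈-factorizations⁻ = splitList⁻ (splitList⁻ ∈-splitℕ⁻)

∈-factorizations⁺ : ∀ {x y m} → Factors x y m → (x , y) ∈ factorizations m
∈-factorizations⁺ = splitList⁺ (splitList⁺ ∈-splitℕ⁺)

-- Factoring over exponents, and the counit

prodOver : (A → ℚ) → List A → ℚ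
prodOver φ []       = 1ℚ
prodOver φ (x ∷ xs) = φ x * prodOver φ xs

prodOver-cong : ∀ {φ ψ : A → ℚ} → (∀ x → φ x ≡ ψ x) → ∀ xs → prodOver φ xs ≡ prodOver ψ xs
prodOver-cong eq []       = refl
prodOver-cong eq (x ∷ xs) = cong₂ _*_ (eq x) (prodOver-cong eq xs)

indicator-all : ∀ {P : Pred A _} (P? : Decidable P) xs →
                indicator (All.all? P? xs) ≡ prodOver (indicator ∘ P?) xs
indicator-all P? []       = refl
indicator-all P? (x ∷ xs) = trans (indicator-× (P? x) (All.all? P? xs))
  (cong (indicator (P? x) *_) (indicator-all P? xs))

splitSum-*ˡ : ∀ (split : A → List (A × A)) a c F →
              splitSum split a (λ x y → c * F x y) ≡ c * splitSum split a F
splitSum-*ˡ split a c F = sumOver-*ˡ (split a) c _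

splitSum-*ʳ : ∀ (split : A → List (A × A)) a F c →
              splitSum split a (λ x y → F x y * c) ≡ splitSum split a F * c
splitSum-*ʳ split a F c = sumOver-*ʳ (split a) _ c

-- The distributive law: a splitting of a list is an independent choice of a splitting of each
-- entry. Used twice, it reduces an identity about monomials to one about a single exponent.
splitSum-prodOver : ∀ (split : A → List (A × A)) (φ ψ : A → ℚ) xs →
  splitSum (splitList split) xs (λ as bs → prodOver φ as * prodOver ψ bs) ≡
  prodOver (λ x → splitSum split x (λ a b → φ a * ψ b)) xs
splitSum-prodOver split φ ψ []       = ℚ.+-identityʳ (1ℚ * 1ℚ)
splitSum-prodOver split φ ψ (x ∷ xs) = begin
  splitSum (splitList split) (x ∷ xs) (λ as bs → prodOver φ as * prodOver ψ bs)
    ≡⟨ splitSum-∷ split x xs _ ⟩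
  splitSum split x (λ a b → splitSum (splitList split) xs (λ as bs →
    φ a * prodOver φ as * (ψ b * prodOver ψ bs)))
    ≡⟨ splitSum-cong split x (λ a b → trans
         (splitSum-cong (splitList split) xs (λ as bs →
           *-interchange (φ a) (prodOver φ as) (ψ b) (prodOver ψ bs)))
         (splitSum-*ˡ (splitList split) xs (φ a * ψ b) _)) ⟩
  splitSum split x (λ a b → φ a * ψ b * splitSum (splitList split) xs (λ as bs →
    prodOver φ as * prodOver ψ bs))
    ≡⟨ splitSum-*ʳ split x (λ a b → φ a * ψ b) _ ⟩
  splitSum split x (λ a b → φ a * ψ b) * splitSum (splitList split) xs (λ as bs →
    prodOver φ as * prodOver ψ bs)
    ≡⟨ cong (splitSum split x (λ a b → φ a * ψ b) *_) (splitSum-prodOver split φ ψ xs) ⟩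
  prodOver (λ x → splitSum split x (λ a b → φ a * ψ b)) (x ∷ xs) ∎
  where open ≡-Reasoning

-- On monomials the counit is the coefficient of `one`, so this law is dual to the identity law of
-- `·`.
IsCounit : (A → List (A × A)) → (A → ℚ) → Set
IsCounit {A} split ε = ∀ a (F : A → ℚ) → splitSum split a (λ x y → ε x * F y) ≡ F a

splitList-counit : ∀ {split : A → List (A × A)} {ε} → IsCounit split ε →
                   IsCounit (splitList split) (prodOver ε)
splitList-counit counit [] F = trans
  (ℚ.+-identityʳ (1ℚ * F [])) (ℚ.*-identityˡ (F []))
splitList-counit {split = split} {ε} counit (x ∷ xs) F = begin
  splitSum (splitList split) (x ∷ xs) (λ as bs → prodOver ε as * F bs)
    ≡⟨ splitSum-∷ split x xs _ ⟩
  splitSum split x (λ a b → splitSum (splitList split) xs (λ as bs →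
    ε a * prodOver ε as * F (b ∷ bs)))
    ≡⟨ splitSum-cong split x (λ a b → trans
         (splitSum-cong (splitList split) xs (λ as bs → ℚ.*-assoc (ε a) (prodOver ε as) _))
         (trans (splitSum-*ˡ (splitList split) xs (ε a) _)
           (cong (ε a *_) (splitList-counit counit xs (λ bs → F (b ∷ bs)))))) ⟩
  splitSum split x (λ a b → ε a * F (b ∷ xs))
    ≡⟨ counit x (λ b → F (b ∷ xs)) ⟩
  F (x ∷ xs) ∎
  where open ≡-Reasoning

splitℕ-counit : IsCounit splitℕ (λ e → indicator (e ℕ.≟ 0))
splitℕ-counit zero    F = trans (ℚ.+-identityʳ (1ℚ * F 0)) (ℚ.*-identityˡ (F 0))
splitℕ-counit (suc e) F = begin
  splitSum splitℕ (suc e) (λ x y → indicator (x ℕ.≟ 0) * F y)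
    ≡⟨ splitSum-suc e (λ x y → indicator (x ℕ.≟ 0) * F y) ⟩
  1ℚ * F (suc e) + splitSum splitℕ e (λ x y → 0ℚ * F y)
    ≡⟨ cong₂ _+_ (ℚ.*-identityˡ (F (suc e)))
         (trans (splitSum-*ˡ splitℕ e 0ℚ (λ x y → F y))
           (ℚ.*-zeroˡ (splitSum splitℕ e (λ x y → F y)))) ⟩
  F (suc e) + 0ℚ
    ≡⟨ ℚ.+-identityʳ (F (suc e)) ⟩
  F (suc e) ∎
  where open ≡-Reasoning

-- The commutative monoid of power series

infix 4 _≐_
_≐_ : PowerSeries → PowerSeries → Set
F ≐ G = ∀ m → coeff F m ≡ coeff G m

·-cong : ∀ F F′ G G′ → F ≐ F′ → G ≐ G′ → F · G ≐ F′ · G′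
·-cong F F′ G G′ p q m = splitSum-cong factorizations m (λ x y → cong₂ _*_ (p x) (q y))

·-congˡ : ∀ F G G′ → G ≐ G′ → F · G ≐ F · G′
·-congˡ F G G′ = ·-cong F F G G′ (λ _ → refl)

·-comm : ∀ F G → F · G ≐ G · F
·-comm F G m = trans (IsCocommutative.comm factorizations-isCocommutative m _)
  (splitSum-cong factorizations m (λ x y → ℚ.*-comm (coeff F y) (coeff G x)))

·-assoc : ∀ F G K → F · G · K ≐ F · (G · K)
·-assoc F G K m = begin
  S m (λ x z → S x (λ u v → f u * g v) * k z)
    ≡⟨ splitSum-cong factorizations m (λ x z → splitSum-*ʳ factorizations x _ (k z)) ⟨
  S m (λ x z → S x (λ u v → f u * g v * k z))
    ≡⟨ IsCocommutative.assoc factorizations-isCocommutative m _ ⟩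
  S m (λ u z → S z (λ v w → f u * g v * k w))
    ≡⟨ splitSum-cong factorizations m (λ u z → trans
         (splitSum-cong factorizations z (λ v w → ℚ.*-assoc (f u) (g v) (k w)))
         (splitSum-*ˡ factorizations z (f u) _)) ⟩
  S m (λ u z → f u * S z (λ v w → g v * k w)) ∎
  where
  open ≡-Reasoning
  S = splitSum factorizations
  f = coeff F
  g = coeff G
  k = coeff K

·-identityˡ : ∀ F → one · F ≐ F
·-identityˡ F m = trans
  (splitSum-cong factorizations m (λ x y → cong (_* coeff F y)
    (trans (indicator-all (All.all? (ℕ._≟ 0)) x)
      (prodOver-cong (indicator-all (ℕ._≟ 0)) x))))
  (splitList-counit (splitList-counit splitℕ-counit) m (coeff F))

·-identityʳ : ∀ F → F · one ≐ F
·-identityʳ F m = trans (·-comm F one m) (·-identityˡ F m)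

-- Coefficients of H and E⁺ at a block, and square-free times square

sum-split : ∀ {as bs es} → RowSplit as bs es → sum as ℕ.+ sum bs ≡ sum es
sum-split []                                     = refl
sum-split (_∷_ {a} {b} {_} {as} {bs} refl rs) = trans
  (rearrange a (sum as) b (sum bs)) (cong (a ℕ.+ b ℕ.+_) (sum-split rs))
  where
  rearrange : ∀ a s b t → a ℕ.+ s ℕ.+ (b ℕ.+ t) ≡ a ℕ.+ b ℕ.+ (s ℕ.+ t)
  rearrange = ℕ-Ring.solve-∀

weight-split : ∀ k {x y m} → Factors x y m →
  weight k (map sum x) ℕ.+ weight k (map sum y) ≡ weight k (map sum m)
weight-split k []       = refl
weight-split k (_∷_ {a} {b} {e} {as} {bs} r rs) = trans
  (rearrange k (sum a) (weight (suc k) (map sum as)) (sum b) (weight (suc k) (map sum bs)))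
  (cong₂ (λ s t → k ℕ.* s ℕ.+ t) (sum-split r) (weight-split (suc k) rs))
  where
  rearrange : ∀ k a s b t → k ℕ.* a ℕ.+ s ℕ.+ (k ℕ.* b ℕ.+ t) ≡
                            k ℕ.* (a ℕ.+ b) ℕ.+ (s ℕ.+ t)
  rearrange = ℕ-Ring.solve-∀

power? : ∀ r → Decidable (AllExp (r ∣_))
power? r = All.all? (All.all? (r ∣?_))

sum-root : ∀ r .{{_ : NonZero r}} {es} → All (r ∣_) es → sum es ≡ r ℕ.* sum (map (_/ r) es)
sum-root r []                  = sym (ℕ.*-zeroʳ r)
sum-root r (_∷_ {e} {es} d ds) = trans (cong₂ ℕ._+_ (sym (m*[n/m]≡n d)) (sum-root r ds))
  (sym (ℕ.*-distribˡ-+ r (e / r) (sum (map (_/ r) es))))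

weight-root : ∀ k r .{{_ : NonZero r}} {m} → AllExp (r ∣_) m →
              weight k (map sum m) ≡ r ℕ.* weight k (map sum (root r m))
weight-root k r []                      = sym (ℕ.*-zeroʳ r)
weight-root k r (_∷_ {row} {m} ds dss) = trans
  (cong₂ (λ s t → k ℕ.* s ℕ.+ t) (sum-root r ds) (weight-root (suc k) r dss))
  (rearrange k r (sum (map (_/ r) row)) (weight (suc k) (map sum (root r m))))
  where
  rearrange : ∀ k r s t → k ℕ.* (r ℕ.* s) ℕ.+ r ℕ.* t ≡ r ℕ.* (k ℕ.* s ℕ.+ t)
  rearrange = ℕ-Ring.solve-∀

deg-root : ∀ r .{{_ : NonZero r}} d {m} → AllExp (r ∣_) m →
           (deg (root r m) ≡ d) ⇔ (deg m ≡ r ℕ.* d)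
deg-root r d ps = mk⇔
  (λ eq → trans (weight-root 1 r ps) (cong (r ℕ.*_) eq))
  (λ eq → ℕ.*-cancelˡ-≡ _ _ r (trans (sym (weight-root 1 r ps)) eq))

-- For an r-th power the degree of the root is the degree of `m` divided by `r`. Eliminating the
-- root leaves one condition on the exponents and one on the degree, each of which behaves well
-- under factorization.
coeff-H : ∀ d r .{{_ : NonZero r}} m →
  coeff (H d ⟨ r ⟩) m ≡ indicator (power? r m) * indicator (deg m ℕ.≟ r ℕ.* d)
coeff-H d r m = trans (indicator-if (power? r m) _)
  (indicator-*-cong (power? r m) λ ps →
    indicator-cong (deg (root r m) ℕ.≟ d) (deg m ℕ.≟ r ℕ.* d) (deg-root r d {m} ps))

SqfreePower : ∀ r → .{{NonZero r}} → Pred ℕ _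
SqfreePower r e = r ∣ e × e / r ≤ 1

sqfreePower? : ∀ r .{{_ : NonZero r}} → Decidable (SqfreePower r)
sqfreePower? r e = (r ∣? e) ×-dec (e / r ℕ.≤? 1)

-- Divisibility by `r` and square-freeness of the root merge into the single condition
-- `SqfreePower r` on each exponent, the shape that `splitSum-prodOver` asks for.
coeff-E⁺ : ∀ d r .{{_ : NonZero r}} m → coeff (E⁺ d ⟨ r ⟩) m ≡
  indicator (All.all? (All.all? (sqfreePower? r)) m) * indicator (deg m ℕ.≟ r ℕ.* d)
coeff-E⁺ d r m = begin
  coeff (E⁺ d ⟨ r ⟩) m
    ≡⟨ indicator-if (power? r m) _ ⟩
  indicator (power? r m) * indicator ((deg (root r m) ℕ.≟ d) ×-dec squareFree? (root r m))
    ≡⟨ indicator-× (power? r m)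
         ((deg (root r m) ℕ.≟ d) ×-dec squareFree? (root r m)) ⟨
  indicator (power? r m ×-dec ((deg (root r m) ℕ.≟ d) ×-dec squareFree? (root r m)))
    ≡⟨ indicator-cong (power? r m ×-dec ((deg (root r m) ℕ.≟ d) ×-dec squareFree? (root r m)))
         (sqfreePowers? ×-dec (deg m ℕ.≟ r ℕ.* d)) (mk⇔ to from) ⟩
  indicator (sqfreePowers? ×-dec (deg m ℕ.≟ r ℕ.* d))
    ≡⟨ indicator-× sqfreePowers? (deg m ℕ.≟ r ℕ.* d) ⟩
  indicator sqfreePowers? * indicator (deg m ℕ.≟ r ℕ.* d) ∎
  where
  open ≡-Reasoning
  open Equivalence using () renaming (to to ⇒; from to ⇐)
  sqfreePowers? : Dec (AllExp (SqfreePower r) m)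
  sqfreePowers? = All.all? (All.all? (sqfreePower? r)) m
  both : ∀ {es} → All (r ∣_) es → All (_≤ 1) (map (_/ r) es) → All (SqfreePower r) es
  both []       []       = []
  both (p ∷ ps) (q ∷ qs) = (p , q) ∷ both ps qs
  both² : ∀ {m} → AllExp (r ∣_) m → SquareFree (root r m) → AllExp (SqfreePower r) m
  both² []       []       = []
  both² (p ∷ ps) (q ∷ qs) = both p q ∷ both² ps qs
  to : AllExp (r ∣_) m × deg (root r m) ≡ d × SquareFree (root r m) →
       AllExp (SqfreePower r) m × deg m ≡ r ℕ.* d
  to (ps , eq , sq) = both² ps sq , ⇒ (deg-root r d {m} ps) eq
  from : AllExp (SqfreePower r) m × deg m ≡ r ℕ.* d →
         AllExp (r ∣_) m × deg (root r m) ≡ d × SquareFree (root r m)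
  from (qs , eq) = ps , ⇐ (deg-root r d {m} ps) eq , sqs qs
    where
    ps = All.map (All.map proj₁) qs
    sq : ∀ {es} → All (SqfreePower r) es → All (_≤ 1) (map (_/ r) es)
    sq []             = []
    sq ((_ , q) ∷ qs) = q ∷ sq qs
    sqs : ∀ {m} → AllExp (SqfreePower r) m → SquareFree (root r m)
    sqs []        = []
    sqs (q ∷ qs) = sq q ∷ sqs qs

-- An exponent rq is r(q mod 2) + 2r⌊q/2⌋, and this is its only decomposition
-- as one of 0 and r plus a multiple of 2r.
sqfreeTimesSquare-entry : ∀ r .{{_ : NonZero r}} e →
  splitSum splitℕ e (λ a b → indicator (sqfreePower? r a) * indicator ((2 ℕ.* r) ∣? b)) ≡
  indicator (r ∣? e)
sqfreeTimesSquare-entry r e = trans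
  (sumOver-map (λ k → k , e ∸ k) (upTo (suc e))
    (λ p → indicator (sqfreePower? r (proj₁ p)) * indicator ((2 ℕ.* r) ∣? proj₂ p)))
  (trans (sumOver-cong (upTo (suc e)) λ k →
      sym (indicator-× (sqfreePower? r k) ((2 ℕ.* r) ∣? (e ∸ k))))
    (sumOver-indicator (λ k → sqfreePower? r k ×-dec ((2 ℕ.* r) ∣? (e ∸ k)))
      (r ∣? e) (Unique.upTo⁺ (suc e)) same find imp))
  where
  P : ℕ → Set
  P k = SqfreePower r k × 2 ℕ.* r ∣ e ∸ k

  digits : ∀ {k} → k ∈ upTo (suc e) → P k →
           ∃ λ a → ∃ λ c → a ≤ 1 × k ≡ a ℕ.* r × e ≡ (a ℕ.+ 2 ℕ.* c) ℕ.* r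
  digits {k} k∈ ((divides a k≡ , a≤1) , divides c eq) =
    a , c , subst (_≤ 1) (trans (cong (_/ r) k≡) (m*n/n≡m a r)) a≤1 , k≡ , (begin
      e                              ≡⟨ ℕ.m+[n∸m]≡n (ℕ.s≤s⁻¹ (∈-upTo⁻ k∈)) ⟨
      k ℕ.+ (e ∸ k)                  ≡⟨ cong₂ ℕ._+_ k≡ eq ⟩
      a ℕ.* r ℕ.+ c ℕ.* (2 ℕ.* r)    ≡⟨ rearrange a c r ⟩
      (a ℕ.+ 2 ℕ.* c) ℕ.* r          ∎)
    where
    open ≡-Reasoning
    rearrange : ∀ a c r → a ℕ.* r ℕ.+ c ℕ.* (2 ℕ.* r) ≡ (a ℕ.+ 2 ℕ.* c) ℕ.* r
    rearrange = ℕ-Ring.solve-∀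

  digit-unique : ∀ {a a′} c c′ → a ≤ 1 → a′ ≤ 1 → a ℕ.+ 2 ℕ.* c ≡ a′ ℕ.+ 2 ℕ.* c′ → a ≡ a′
  digit-unique c c′ z≤n       z≤n       eq = refl
  digit-unique c c′ z≤n       (s≤s z≤n) eq = contradiction eq (ℕ.even≢odd c c′)
  digit-unique c c′ (s≤s z≤n) z≤n       eq = contradiction (sym eq) (ℕ.even≢odd c′ c)
  digit-unique c c′ (s≤s z≤n) (s≤s z≤n) eq = refl

  same : ∀ {k l} → k ∈ upTo (suc e) → l ∈ upTo (suc e) → P k → P l → k ≡ l
  same k∈ l∈ p q with a , c , a≤1 , refl , eq ← digits k∈ p
                    | b , c′ , b≤1 , refl , eq′ ← digits l∈ q =
    cong (ℕ._* r) (digit-unique c c′ a≤1 b≤1 (ℕ.*-cancelʳ-≡ _ _ r (trans (sym eq) eq′)))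

  find : r ∣ e → ∃ λ k → k ∈ upTo (suc e) × P k
  find (divides q refl) = k , ∈-upTo⁺ (s≤s k≤) ,
    (divides (q % 2) refl , subst (_≤ 1) (sym (m*n/n≡m (q % 2) r)) (ℕ.s≤s⁻¹ (m%n<n q 2))) ,
    divides (q / 2) (trans (cong (_∸ k) split) (ℕ.m+n∸m≡n k _))
    where
    k = q % 2 ℕ.* r
    split : q ℕ.* r ≡ k ℕ.+ q / 2 ℕ.* (2 ℕ.* r)
    split = trans (cong (ℕ._* r) (m≡m%n+[m/n]*n q 2)) (rearrange (q % 2) (q / 2) r)
      where
      rearrange : ∀ a c r → (a ℕ.+ c ℕ.* 2) ℕ.* r ≡ a ℕ.* r ℕ.+ c ℕ.* (2 ℕ.* r)
      rearrange = ℕ-Ring.solve-∀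
    k≤ : k ≤ q ℕ.* r
    k≤ = ℕ.≤-trans (ℕ.m≤m+n k _) (ℕ.≤-reflexive (sym split))

  imp : ∀ {k} → k ∈ upTo (suc e) → P k → r ∣ e
  imp k∈ p with a , c , _ , _ , eq ← digits k∈ p = divides (a ℕ.+ 2 ℕ.* c) eq

sqfreeTimesSquare : ∀ r .{{_ : NonZero r}} m →
  splitSum factorizations m (λ x y →
    indicator (All.all? (All.all? (sqfreePower? r)) x) * indicator (power? (2 ℕ.* r) y)) ≡
  indicator (power? r m)
sqfreeTimesSquare r m = begin
  splitSum factorizations m (λ x y →
    indicator (All.all? (All.all? (sqfreePower? r)) x) * indicator (power? (2 ℕ.* r) y))
    ≡⟨ splitSum-cong factorizations m (λ x y →
         cong₂ _*_ (nested (sqfreePower? r) x) (nested ((2 ℕ.* r) ∣?_) y)) ⟩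
  splitSum factorizations m (λ x y → prodOver (prodOver φ) x * prodOver (prodOver ψ) y)
    ≡⟨ splitSum-prodOver (splitList splitℕ) (prodOver φ) (prodOver ψ) m ⟩
  prodOver (λ row → splitSum (splitList splitℕ) row (λ a b → prodOver φ a * prodOver ψ b)) m
    ≡⟨ prodOver-cong (λ row → trans (splitSum-prodOver splitℕ φ ψ row)
         (prodOver-cong (sqfreeTimesSquare-entry r) row)) m ⟩
  prodOver (prodOver (indicator ∘ (r ∣?_))) m
    ≡⟨ nested (r ∣?_) m ⟨
  indicator (power? r m) ∎
  where
  open ≡-Reasoning
  φ ψ : ℕ → ℚ
  φ = indicator ∘ sqfreePower? r
  ψ = indicator ∘ ((2 ℕ.* r) ∣?_)
  nested : ∀ {P : Pred ℕ _} (P? : Decidable P) m →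
           indicator (All.all? (All.all? P?) m) ≡ prodOver (prodOver (indicator ∘ P?)) m
  nested P? m = trans (indicator-all (All.all? P?) m) (prodOver-cong (indicator-all P?) m)

≤half⇒double≤ : ∀ {b d} → b ≤ d / 2 → 2 ℕ.* b ≤ d
≤half⇒double≤ {b} {d} le = ℕ.≤-trans
  (ℕ.≤-reflexive (ℕ.*-comm 2 b)) (ℕ.≤-trans (ℕ.*-monoˡ-≤ 2 le) (m/n*n≤m d 2))

double≤⇒≤half : ∀ {b d} → 2 ℕ.* b ≤ d → b ≤ d / 2
double≤⇒≤half {b} {d} le = subst (_≤ d / 2) (m*n/n≡m b 2)
  (/-monoˡ-≤ 2 (subst (_≤ d) (ℕ.*-comm 2 b) le))

-- The second equation forces b = Y / 2r. If X + Y = rd then Y ≤ rd, so this b lies in the range of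
-- summation; conversely, b ≤ d / 2 makes the subtraction in `d ∸ 2 ℕ.* b` exact.
degreeSplits : ∀ r .{{_ : NonZero r}} d {X Y} → 2 ℕ.* r ∣ Y →
  ∑[ b ∈ upTo (suc (d / 2)) ]
    (indicator (X ℕ.≟ r ℕ.* (d ∸ 2 ℕ.* b)) * indicator (Y ℕ.≟ 2 ℕ.* r ℕ.* b)) ≡
  indicator (X ℕ.+ Y ℕ.≟ r ℕ.* d)
degreeSplits r d {X} {Y} (divides c Y≡) = trans
  (sumOver-cong (upTo (suc (d / 2))) λ b →
    sym (indicator-× (X ℕ.≟ r ℕ.* (d ∸ 2 ℕ.* b)) (Y ℕ.≟ 2 ℕ.* r ℕ.* b)))
  (sumOver-indicator (λ b → (X ℕ.≟ r ℕ.* (d ∸ 2 ℕ.* b)) ×-dec (Y ℕ.≟ 2 ℕ.* r ℕ.* b))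
    (X ℕ.+ Y ℕ.≟ r ℕ.* d) (Unique.upTo⁺ (suc (d / 2))) (λ _ _ → same) find imp)
  where
  P : ℕ → Set
  P b = X ≡ r ℕ.* (d ∸ 2 ℕ.* b) × Y ≡ 2 ℕ.* r ℕ.* b

  instance
    2r≢0 : NonZero (2 ℕ.* r)
    2r≢0 = ℕ.m*n≢0 2 r

  same : ∀ {b b′} → P b → P b′ → b ≡ b′
  same (_ , p) (_ , q) = ℕ.*-cancelˡ-≡ _ _ (2 ℕ.* r) (trans (sym p) q)

  double-comm : ∀ r c → 2 ℕ.* r ℕ.* c ≡ r ℕ.* (2 ℕ.* c)
  double-comm = ℕ-Ring.solve-∀

  Y≡′ : Y ≡ r ℕ.* (2 ℕ.* c)
  Y≡′ = trans Y≡ (trans (ℕ.*-comm c (2 ℕ.* r)) (double-comm r c))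

  find : X ℕ.+ Y ≡ r ℕ.* d → ∃ λ b → b ∈ upTo (suc (d / 2)) × P b
  find eq = c , ∈-upTo⁺ (s≤s (double≤⇒≤half (ℕ.*-cancelˡ-≤ r
      (subst₂ _≤_ Y≡′ eq (ℕ.m≤n+m Y X))))) ,
    (begin
      X                                ≡⟨ ℕ.m+n∸n≡m X Y ⟨
      X ℕ.+ Y ∸ Y                      ≡⟨ cong₂ _∸_ eq Y≡′ ⟩
      r ℕ.* d ∸ r ℕ.* (2 ℕ.* c)        ≡⟨ ℕ.*-distribˡ-∸ r d (2 ℕ.* c) ⟨
      r ℕ.* (d ∸ 2 ℕ.* c)              ∎) ,
    trans Y≡ (ℕ.*-comm c (2 ℕ.* r))
    where open ≡-Reasoning

  imp : ∀ {b} → b ∈ upTo (suc (d / 2)) → P b → X ℕ.+ Y ≡ r ℕ.* d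
  imp {b} b∈ (refl , refl) = begin
    r ℕ.* (d ∸ 2 ℕ.* b) ℕ.+ 2 ℕ.* r ℕ.* b
      ≡⟨ cong (r ℕ.* (d ∸ 2 ℕ.* b) ℕ.+_) (double-comm r b) ⟩
    r ℕ.* (d ∸ 2 ℕ.* b) ℕ.+ r ℕ.* (2 ℕ.* b)
      ≡⟨ ℕ.*-distribˡ-+ r (d ∸ 2 ℕ.* b) (2 ℕ.* b) ⟨
    r ℕ.* (d ∸ 2 ℕ.* b ℕ.+ 2 ℕ.* b)
      ≡⟨ cong (r ℕ.*_) (ℕ.m∸n+n≡m (≤half⇒double≤ (ℕ.s≤s⁻¹ (∈-upTo⁻ b∈)))) ⟩
    r ℕ.* d ∎
    where open ≡-Reasoning

-- Every monomial is uniquely a square-free monomial times a square.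
E⁺-H-convolution : ∀ r .{{_ : NonZero r}} d m →
  ∑[ b ∈ upTo (suc (d / 2)) ]
    coeff (E⁺ (d ∸ 2 ℕ.* b) ⟨ r ⟩ · _⟨_⟩ (H b) (2 ℕ.* r) {{ℕ.m*n≢0 2 r}}) m ≡
  coeff (H d ⟨ r ⟩) m
E⁺-H-convolution r d m = begin
  ∑[ b ∈ bs ] splitSum factorizations m (λ x y →
    coeff (E⁺ (d ∸ 2 ℕ.* b) ⟨ r ⟩) x * coeff (_⟨_⟩ (H b) (2 ℕ.* r)) y)
    ≡⟨ sumOver-swap bs (factorizations m) _ ⟩
  splitSum factorizations m (λ x y → ∑[ b ∈ bs ]
    (coeff (E⁺ (d ∸ 2 ℕ.* b) ⟨ r ⟩) x * coeff (_⟨_⟩ (H b) (2 ℕ.* r)) y))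
    ≡⟨ splitSum-cong factorizations m (λ x y → trans
         (sumOver-cong bs (λ b → trans
           (cong₂ _*_ (coeff-E⁺ (d ∸ 2 ℕ.* b) r x) (coeff-H b (2 ℕ.* r) y))
           (*-interchange (Φ x) _ (Ψ y) _)))
         (sumOver-*ˡ bs (Φ x * Ψ y) _)) ⟩
  splitSum factorizations m (λ x y → Φ x * Ψ y * ∑[ b ∈ bs ]
    (indicator (deg x ℕ.≟ r ℕ.* (d ∸ 2 ℕ.* b)) * indicator (deg y ℕ.≟ 2 ℕ.* r ℕ.* b)))
    ≡⟨ sumOver-cong-∈ (factorizations m) (λ (x , y) xy∈ → degrees x y (∈-factorizations⁻ xy∈)) ⟩
  splitSum factorizations m (λ x y → Φ x * Ψ y * indicator (deg m ℕ.≟ r ℕ.* d))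
    ≡⟨ splitSum-*ʳ factorizations m (λ x y → Φ x * Ψ y) _ ⟩
  splitSum factorizations m (λ x y → Φ x * Ψ y) * indicator (deg m ℕ.≟ r ℕ.* d)
    ≡⟨ cong (_* indicator (deg m ℕ.≟ r ℕ.* d)) (sqfreeTimesSquare r m) ⟩
  indicator (power? r m) * indicator (deg m ℕ.≟ r ℕ.* d)
    ≡⟨ coeff-H d r m ⟨
  coeff (H d ⟨ r ⟩) m ∎
  where
  open ≡-Reasoning
  instance
    2r≢0 : NonZero (2 ℕ.* r)
    2r≢0 = ℕ.m*n≢0 2 r
  bs = upTo (suc (d / 2))
  Φ Ψ : Monomial → ℚ
  Φ x = indicator (All.all? (All.all? (sqfreePower? r)) x)
  Ψ y = indicator (power? (2 ℕ.* r) y)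
  -- The factor `Ψ y` provides the divisibility of `deg y` by 2r that `degreeSplits` needs; where it
  -- vanishes, both sides are 0.
  degrees : ∀ x y → Factors x y m →
    Φ x * Ψ y * ∑[ b ∈ bs ]
      (indicator (deg x ℕ.≟ r ℕ.* (d ∸ 2 ℕ.* b)) * indicator (deg y ℕ.≟ 2 ℕ.* r ℕ.* b)) ≡
    Φ x * Ψ y * indicator (deg m ℕ.≟ r ℕ.* d)
  degrees x y xy = trans (ℚ.*-assoc (Φ x) (Ψ y) _) (trans
    (cong (Φ x *_) (indicator-*-cong (power? (2 ℕ.* r) y) λ ps → trans
      (degreeSplits r d {deg x} {deg y} (divides (deg (root (2 ℕ.* r) y))
        (trans (weight-root 1 (2 ℕ.* r) ps) (ℕ.*-comm (2 ℕ.* r) _))))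
      (cong (λ e → indicator (e ℕ.≟ r ℕ.* d)) (weight-split 1 xy))))
    (sym (ℚ.*-assoc (Φ x) (Ψ y) _)))

-- Duplicate-free lists with the same elements are permutations of each other. This exchanges an
-- enumeration obtained by filtering candidates for one with a recursive structure.
sumOver-filtered : ∀ {P : A → Set} (P? : Decidable P) {xs ys : List A} (f : A → ℚ) →
  Unique xs → Unique ys → (∀ {y} → y ∈ ys → y ∈ xs × P y) → (∀ {x} → x ∈ xs → P x → x ∈ ys) →
  ∑[ x ∈ xs ] (indicator (P? x) * f x) ≡ sumOver ys f
sumOver-filtered P? {xs} {ys} f xs! ys! sound complete = trans (filtered xs)
  (sumOver-↭ f (∼bag⇒↭ (unique∧set⇒bag (Unique.filter⁺ P? xs!) ys! (mk⇔
    (λ x∈ → let x∈xs , p = ∈-filter⁻ P? x∈ in complete x∈xs p)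
    (λ y∈ → let y∈xs , p = sound y∈ in ∈-filter⁺ P? y∈xs p)))))
  where
  filtered : ∀ xs → ∑[ x ∈ xs ] (indicator (P? x) * f x) ≡ sumOver (filter P? xs) f
  filtered []       = refl
  filtered (x ∷ xs) with P? x
  ... | yes _ = cong₂ _+_ (ℚ.*-identityˡ (f x)) (filtered xs)
  ... | no _  = trans (cong (_+ _) (ℚ.*-zeroˡ (f x))) (trans (ℚ.+-identityˡ _) (filtered xs))

-- The linear combination stands coefficientwise inside the convolution, so that an identity known
-- for its coefficient at every `x` can be substituted there.
·-linearˡ : ∀ (is : List A) (c : A → ℚ) (F : A → PowerSeries) G m →
  ∑[ i ∈ is ] (c i * coeff (F i · G) m) ≡
  splitSum factorizations m (λ x y → ∑[ i ∈ is ] (c i * coeff (F i) x) * coeff G y)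
·-linearˡ is c F G m = begin
  ∑[ i ∈ is ] (c i * coeff (F i · G) m)
    ≡⟨ sumOver-cong is (λ i → splitSum-*ˡ factorizations m (c i) _) ⟨
  ∑[ i ∈ is ] splitSum factorizations m (λ x y → c i * (coeff (F i) x * coeff G y))
    ≡⟨ sumOver-swap is (factorizations m) _ ⟩
  splitSum factorizations m (λ x y → ∑[ i ∈ is ] (c i * (coeff (F i) x * coeff G y)))
    ≡⟨ splitSum-cong factorizations m (λ x y → trans
         (sumOver-cong is (λ i → sym (ℚ.*-assoc (c i) _ _)))
         (sumOver-*ʳ is (λ i → c i * coeff (F i) x) (coeff G y))) ⟩
  splitSum factorizations m (λ x y → ∑[ i ∈ is ] (c i * coeff (F i) x) * coeff G y) ∎
  where open ≡-Reasoning

-- Products over lists of blocks, and the recursion for E⁺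

blocksSeries : (ℕ → PowerSeries) → List Block → PowerSeries
blocksSeries F bs = foldr _·_ one (map (blockSeries F) bs)

blocksSeries-++ : ∀ F bs cs →
  blocksSeries F (bs ++ cs) ≐ blocksSeries F bs · blocksSeries F cs
blocksSeries-++ F []       cs m = sym (·-identityˡ (blocksSeries F cs) m)
blocksSeries-++ F (b ∷ bs) cs m = trans
  (·-congˡ (blockSeries F b) (blocksSeries F (bs ++ cs))
    (blocksSeries F bs · blocksSeries F cs) (blocksSeries-++ F bs cs) m)
  (sym (·-assoc (blockSeries F b) (blocksSeries F bs) (blocksSeries F cs) m))

blocksSeries-↭ : ∀ F {bs cs} → bs ↭ cs → blocksSeries F bs ≐ blocksSeries F cs
blocksSeries-↭ F Perm.refl        m = refl
blocksSeries-↭ F (Perm.prep {bs} {cs} b p) m =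
  ·-congˡ (blockSeries F b) (blocksSeries F bs) (blocksSeries F cs) (blocksSeries-↭ F p) m
blocksSeries-↭ F (Perm.swap {bs} {cs} b c p) m = begin
  coeff (Fb · (Fc · blocksSeries F bs)) m
    ≡⟨ ·-assoc Fb Fc (blocksSeries F bs) m ⟨
  coeff (Fb · Fc · blocksSeries F bs) m
    ≡⟨ ·-cong (Fb · Fc) (Fc · Fb) (blocksSeries F bs) (blocksSeries F cs)
         (·-comm Fb Fc) (blocksSeries-↭ F p) m ⟩
  coeff (Fc · Fb · blocksSeries F cs) m
    ≡⟨ ·-assoc Fc Fb (blocksSeries F cs) m ⟩
  coeff (Fc · (Fb · blocksSeries F cs)) m ∎
  where
  open ≡-Reasoning
  Fb = blockSeries F b
  Fc = blockSeries F c
blocksSeries-↭ F (Perm.trans p q) m = trans (blocksSeries-↭ F p m) (blocksSeries-↭ F q m)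

sum≡0⇒All≡0 : ∀ es → sum es ≡ 0 → All (_≡ 0) es
sum≡0⇒All≡0 []       _  = []
sum≡0⇒All≡0 (e ∷ es) eq =
  ℕ.m+n≡0⇒m≡0 e eq ∷ sum≡0⇒All≡0 es (ℕ.m+n≡0⇒n≡0 e eq)

weight≡0⇒AllExp≡0 : ∀ k .{{_ : NonZero k}} m → weight k (map sum m) ≡ 0 → AllExp (_≡ 0) m
weight≡0⇒AllExp≡0 k []         _  = []
weight≡0⇒AllExp≡0 k (row ∷ m) eq =
  sum≡0⇒All≡0 row (ℕ.m*n≡0⇒m≡0 (sum row) k
    (trans (ℕ.*-comm (sum row) k) (ℕ.m+n≡0⇒m≡0 _ eq))) ∷
  weight≡0⇒AllExp≡0 (suc k) m (ℕ.m+n≡0⇒n≡0 (k ℕ.* sum row) eq)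

All≡0⇒sum≡0 : ∀ {es} → All (_≡ 0) es → sum es ≡ 0
All≡0⇒sum≡0 []          = refl
All≡0⇒sum≡0 (refl ∷ ps) = All≡0⇒sum≡0 ps

AllExp≡0⇒weight≡0 : ∀ k {m} → AllExp (_≡ 0) m → weight k (map sum m) ≡ 0
AllExp≡0⇒weight≡0 k []       = refl
AllExp≡0⇒weight≡0 k (p ∷ ps) = cong₂ ℕ._+_
  (trans (cong (k ℕ.*_) (All≡0⇒sum≡0 p)) (ℕ.*-zeroʳ k)) (AllExp≡0⇒weight≡0 (suc k) ps)

H-zero : ∀ r .{{_ : NonZero r}} → H 0 ⟨ r ⟩ ≐ one
H-zero r m = begin
  coeff (H 0 ⟨ r ⟩) m
    ≡⟨ coeff-H 0 r m ⟩
  indicator (power? r m) * indicator (deg m ℕ.≟ r ℕ.* 0)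
    ≡⟨ indicator-× (power? r m) (deg m ℕ.≟ r ℕ.* 0) ⟨
  indicator (power? r m ×-dec (deg m ℕ.≟ r ℕ.* 0))
    ≡⟨ indicator-cong (power? r m ×-dec (deg m ℕ.≟ r ℕ.* 0))
         (All.all? (All.all? (ℕ._≟ 0)) m) (mk⇔
           (λ (_ , eq) → weight≡0⇒AllExp≡0 1 m (trans eq (ℕ.*-zeroʳ r)))
           (λ zs → All.map (All.map λ { refl → r ∣0 }) zs ,
             trans (AllExp≡0⇒weight≡0 1 zs) (sym (ℕ.*-zeroʳ r)))) ⟩
  coeff one m ∎
  where open ≡-Reasoning

-- As H_0 = 1, the term b = 0 of `E⁺-H-convolution` is the wanted coefficient. The other indices are
-- shifted by one, so that `suc b` is half the length of a doublebrick.
E⁺-recursion : ∀ r .{{_ : NonZero r}} d m →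
  coeff (E⁺ d ⟨ r ⟩) m + ∑[ b ∈ upTo (d / 2) ]
    coeff (E⁺ (d ∸ 2 ℕ.* suc b) ⟨ r ⟩ · _⟨_⟩ (H (suc b)) (2 ℕ.* r) {{ℕ.m*n≢0 2 r}}) m ≡
  coeff (H d ⟨ r ⟩) m
E⁺-recursion r d m = begin
  coeff (E⁺ d ⟨ r ⟩) m + sumOver (upTo (d / 2)) (term ∘ suc)
    ≡⟨ cong₂ _+_ first (sumOver-map suc (upTo (d / 2)) term) ⟨
  term 0 + sumOver (map suc (upTo (d / 2))) term
    ≡⟨ cong (λ bs → term 0 + sumOver bs term) (List.map-upTo suc (d / 2)) ⟩
  sumOver (upTo (suc (d / 2))) term
    ≡⟨ E⁺-H-convolution r d m ⟩
  coeff (H d ⟨ r ⟩) m ∎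
  where
  open ≡-Reasoning
  instance
    2r≢0 : NonZero (2 ℕ.* r)
    2r≢0 = ℕ.m*n≢0 2 r
  term : ℕ → ℚ
  term b = coeff (E⁺ (d ∸ 2 ℕ.* b) ⟨ r ⟩ · _⟨_⟩ (H b) (2 ℕ.* r)) m
  first : term 0 ≡ coeff (E⁺ d ⟨ r ⟩) m
  first = trans
    (·-congˡ (E⁺ d ⟨ r ⟩) (_⟨_⟩ (H 0) (2 ℕ.* r)) one (H-zero (2 ℕ.* r)) m)
    (·-identityʳ (E⁺ d ⟨ r ⟩) m)

-- Rows with at most one brick

undoubledRow : ℕ → List Tile
-- Bricks are non-empty, so nothing is placed in 0 cells; this is the counterpart of H_0 = 1.
undoubledRow zero    = []
undoubledRow (suc d) = brick (suc d) ∷ []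

appendDouble : ℕ → List Tile → List Tile
appendDouble b ts = ts ∷ʳ doublebrick (suc b)

-- The rows of length d with at most one brick, by recursion on the last
-- doublebrick; the first argument is fuel, and d is enough.
goodRows : ℕ → ℕ → List (List Tile)
goodRowsBy : ℕ → ℕ → ℕ → List (List Tile)

goodRows zero    d = undoubledRow d ∷ []
goodRows (suc f) d = undoubledRow d ∷ concat (map (goodRowsBy f d) (upTo (d / 2)))

goodRowsBy f d b = map (appendDouble b) (goodRows f (d ∸ 2 ℕ.* suc b))

sign : List Tile → ℚ
sign ts = (- 1ℚ) ^ #doublebricks ts

#doublebricks-appendDouble : ∀ b ts → #doublebricks (appendDouble b ts) ≡ suc (#doublebricks ts)
#doublebricks-appendDouble b []                   = refl
#doublebricks-appendDouble b (brick _ ∷ ts)       = #doublebricks-appendDouble b ts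
#doublebricks-appendDouble b (doublebrick _ ∷ ts) = cong suc (#doublebricks-appendDouble b ts)

shorter : ∀ {f d} b → d ≤ suc f → d ∸ 2 ℕ.* suc b ≤ f
shorter {d = zero}  b le       = z≤n
shorter {d = suc d} b (s≤s le) = ℕ.≤-trans (ℕ.m∸n≤m d (b ℕ.+ 1 ℕ.* suc b)) le

rowTerm : ∀ r → .{{NonZero r}} → Monomial → List Tile → ℚ
rowTerm r m ts = sign ts * coeff (blocksSeries H (map (tileBlock r) ts)) m

rowTerm-undoubledRow : ∀ r .{{_ : NonZero r}} d m →
                       rowTerm r m (undoubledRow d) ≡ coeff (H d ⟨ r ⟩) m
rowTerm-undoubledRow r zero    m = trans (ℚ.*-identityˡ _) (sym (H-zero r m))
rowTerm-undoubledRow r (suc d) m = trans (ℚ.*-identityˡ _) (·-identityʳ (H (suc d) ⟨ r ⟩) m)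

rowTerm-appendDouble : ∀ r .{{_ : NonZero r}} b m ts →
  rowTerm r m (appendDouble b ts) ≡ - (sign ts * coeff
    (blocksSeries H (map (tileBlock r) ts) · _⟨_⟩ (H (suc b)) (2 ℕ.* r) {{ℕ.m*n≢0 2 r}}) m)
rowTerm-appendDouble r b m ts = begin
  sign (appendDouble b ts) * coeff (blocksSeries H (map (tileBlock r) (appendDouble b ts))) m
    ≡⟨ cong₂ _*_ (cong ((- 1ℚ) ^_) (#doublebricks-appendDouble b ts))
         (trans (cong (λ bs → coeff (blocksSeries H bs) m) (List.map-++ (tileBlock r) ts _))
           (trans (blocksSeries-++ H (map (tileBlock r) ts) _ m)
             (·-congˡ (blocksSeries H (map (tileBlock r) ts)) (G · one) G (·-identityʳ G) m))) ⟩
  - 1ℚ * sign ts * c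
    ≡⟨ cong (_* c) (ℚ.neg-distribˡ-* 1ℚ (sign ts)) ⟨
  - (1ℚ * sign ts) * c
    ≡⟨ cong (λ s → - s * c) (ℚ.*-identityˡ (sign ts)) ⟩
  - sign ts * c
    ≡⟨ ℚ.neg-distribˡ-* (sign ts) c ⟨
  - (sign ts * c) ∎
  where
  open ≡-Reasoning
  G = _⟨_⟩ (H (suc b)) (2 ℕ.* r) {{ℕ.m*n≢0 2 r}}
  c = coeff (blocksSeries H (map (tileBlock r) ts) · G) m

sumOver-neg : ∀ (xs : List A) (f : A → ℚ) → ∑[ x ∈ xs ] (- f x) ≡ - sumOver xs f
sumOver-neg []       f = refl
sumOver-neg (x ∷ xs) f = trans (cong (- f x +_) (sumOver-neg xs f))
  (sym (ℚ.neg-distrib-+ (f x) (sumOver xs f)))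

-- The row without doublebricks contributes H_d, which is E⁺_d plus the sum in `E⁺-recursion`.
-- Removing the last doublebrick from the other rows changes the sign and, by induction, turns their
-- contribution into minus that sum.
goodRows-sum : ∀ r .{{_ : NonZero r}} f d → d ≤ f → ∀ m →
               sumOver (goodRows f d) (rowTerm r m) ≡ coeff (E⁺ d ⟨ r ⟩) m
goodRows-sum r zero zero z≤n m = begin
  rowTerm r m [] + 0ℚ           ≡⟨ cong (_+ 0ℚ) (rowTerm-undoubledRow r 0 m) ⟩
  -- The sum in the recursion is empty for d = 0, hence the additional 0.
  coeff (H 0 ⟨ r ⟩) m + 0ℚ      ≡⟨ cong (_+ 0ℚ) (E⁺-recursion r 0 m) ⟨
  coeff (E⁺ 0 ⟨ r ⟩) m + 0ℚ + 0ℚ ≡⟨ ℚ.+-identityʳ _ ⟩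
  coeff (E⁺ 0 ⟨ r ⟩) m + 0ℚ     ≡⟨ ℚ.+-identityʳ _ ⟩
  coeff (E⁺ 0 ⟨ r ⟩) m          ∎
  where open ≡-Reasoning
goodRows-sum r (suc f) d le m = begin
  rowTerm r m (undoubledRow d) + sumOver (concat (map (goodRowsBy f d) bs)) (rowTerm r m)
    ≡⟨ cong₂ _+_ (trans (rowTerm-undoubledRow r d m) (sym (E⁺-recursion r d m)))
         (sumOver-concatMap (goodRowsBy f d) bs (rowTerm r m)) ⟩
  e + s + ∑[ b ∈ bs ] sumOver (goodRowsBy f d b) (rowTerm r m)
    ≡⟨ cong (e + s +_) (trans (sumOver-cong bs by) (sumOver-neg bs term)) ⟩
  e + s + - s
    ≡⟨ ℚ.+-assoc e s (- s) ⟩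
  e + (s + - s)
    ≡⟨ cong (e +_) (ℚ.+-inverseʳ s) ⟩
  e + 0ℚ
    ≡⟨ ℚ.+-identityʳ e ⟩
  e ∎
  where
  open ≡-Reasoning
  instance
    2r≢0 : NonZero (2 ℕ.* r)
    2r≢0 = ℕ.m*n≢0 2 r
  bs = upTo (d / 2)
  e = coeff (E⁺ d ⟨ r ⟩) m
  term : ℕ → ℚ
  term b = coeff (E⁺ (d ∸ 2 ℕ.* suc b) ⟨ r ⟩ · _⟨_⟩ (H (suc b)) (2 ℕ.* r)) m
  s = sumOver bs term
  by : ∀ b → sumOver (goodRowsBy f d b) (rowTerm r m) ≡ - term b
  by b = begin
    sumOver (map (appendDouble b) rs) (rowTerm r m)
      ≡⟨ sumOver-map (appendDouble b) rs (rowTerm r m) ⟩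
    ∑[ ts ∈ rs ] rowTerm r m (appendDouble b ts)
      ≡⟨ trans (sumOver-cong rs (rowTerm-appendDouble r b m)) (sumOver-neg rs _) ⟩
    - ∑[ ts ∈ rs ] (sign ts * coeff (blocksSeries H (map (tileBlock r) ts) · G) m)
      ≡⟨ cong -_ (·-linearˡ rs sign (λ ts → blocksSeries H (map (tileBlock r) ts)) G m) ⟩
    - splitSum factorizations m (λ x y → sumOver rs (rowTerm r x) * coeff G y)
      ≡⟨ cong -_ (splitSum-cong factorizations m (λ x y →
           cong (_* coeff G y) (goodRows-sum r f (d ∸ 2 ℕ.* suc b) (shorter b le) x))) ⟩
    - term b ∎
    where
    rs = goodRows f (d ∸ 2 ℕ.* suc b)
    G = _⟨_⟩ (H (suc b)) (2 ℕ.* r)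

GoodRow : ℕ → List Tile → Set
GoodRow d ts = IsRow d ts × #bricks ts ≤ 1

#bricks-brick : ∀ ts a .{{_ : NonZero a}} → #bricks (ts ∷ʳ brick a) ≡ suc (#bricks ts)
#bricks-brick []                   a = refl
#bricks-brick (brick _ ∷ ts)       a = cong suc (#bricks-brick ts a)
#bricks-brick (doublebrick _ ∷ ts) a = #bricks-brick ts a

#bricks-doublebrick : ∀ ts b .{{_ : NonZero b}} → #bricks (ts ∷ʳ doublebrick b) ≡ #bricks ts
#bricks-doublebrick []                   b = refl
#bricks-doublebrick (brick _ ∷ ts)       b = cong suc (#bricks-doublebrick ts b)
#bricks-doublebrick (doublebrick _ ∷ ts) b = #bricks-doublebrick ts b

totalLength-∷ʳ : ∀ ts t → sum (map tileLength (ts ∷ʳ t)) ≡ sum (map tileLength ts) ℕ.+ tileLength t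
totalLength-∷ʳ ts t = trans (cong sum (List.map-++ tileLength ts (t ∷ [])))
  (trans (sum-++ (map tileLength ts) (tileLength t ∷ []))
    (cong (sum (map tileLength ts) ℕ.+_) (ℕ.+-identityʳ (tileLength t))))

AllPairs-init : ∀ {R : A → A → Set} xs {x} → AllPairs R (xs ∷ʳ x) → AllPairs R xs
AllPairs-init []       _        = []
AllPairs-init (x ∷ xs) (r ∷ rs) = All.++⁻ˡ xs r ∷ AllPairs-init xs rs

∈-goodRows⁻ : ∀ f d {ts} → ts ∈ goodRows f d → GoodRow d ts
∈-goodRows⁻ f d ts∈ = go f d ts∈
  where
  undoubled : ∀ d → GoodRow d (undoubledRow d)
  undoubled zero    = (refl , []) , z≤n
  undoubled (suc d) = (ℕ.+-identityʳ (suc d) , [] ∷ []) , s≤s z≤n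
  go : ∀ f d {ts} → ts ∈ goodRows f d → GoodRow d ts
  go zero    d (here refl) = undoubled d
  go (suc f) d (here refl) = undoubled d
  go (suc f) d (there ts∈)
    with rs , ts∈rs , rs∈ ← ∈-concat⁻′ (map (goodRowsBy f d) (upTo (d / 2))) ts∈
    with b , b∈ , refl ← ∈-map⁻ (goodRowsBy f d) rs∈
    with us , us∈ , refl ← ∈-map⁻ (appendDouble b) ts∈rs
    with (eq , dr) , br ← go f (d ∸ 2 ℕ.* suc b) us∈
    = (trans (totalLength-∷ʳ us _) (trans (cong (ℕ._+ 2 ℕ.* suc b) eq)
        (ℕ.m∸n+n≡m (≤half⇒double≤ (∈-upTo⁻ b∈)))) ,
       -- Every tile may stand to the left of a doublebrick.
       AllPairs.++⁺ dr ([] ∷ []) (All.universal (λ _ → (λ _ → tt) ∷ []) us)) ,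
      subst (_≤ 1) (sym (#bricks-doublebrick us (suc b))) br

-- The last tile decides. If it is a doublebrick, the recursion applies to the tiles before it; if
-- it is a brick, it must be the whole row.
∈-goodRows⁺ : ∀ f d {ts} → d ≤ f → GoodRow d ts → ts ∈ goodRows f d
∈-goodRows⁺ f d {ts} le good = go f d le ts (initLast ts) good
  where
  undoubled∈ : ∀ f d → undoubledRow d ∈ goodRows f d
  undoubled∈ zero    d = here refl
  undoubled∈ (suc f) d = here refl
  go : ∀ f d → d ≤ f → ∀ ts → InitLast ts → GoodRow d ts → ts ∈ goodRows f d
  go f d le .[] [] ((refl , _) , _) = undoubled∈ f 0
  go f d le .(brick a ∷ []) ([] ∷ʳ′ brick a@(suc a′)) ((refl , _) , _) =
    subst (λ l → brick a ∷ [] ∈ goodRows f l) (sym (ℕ.+-identityʳ a)) (undoubled∈ f a)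
  -- A final brick is preceded neither by a doublebrick, because of the order, nor by a brick,
  -- because of the count.
  go f d le ._ ((doublebrick _ ∷ us) ∷ʳ′ brick a) ((_ , drs ∷ _) , _) =
    contradiction (proj₂ (All.∷ʳ⁻ drs) tt) λ ()
  go f d le ._ ((brick _ ∷ us) ∷ʳ′ brick a) (_ , s≤s br) =
    contradiction (subst (_≤ 0) (#bricks-brick us a) br) λ ()
  -- Without fuel d = 0, which leaves no room for a doublebrick.
  go zero d le ._ (us ∷ʳ′ doublebrick (suc b)) ((eq , _) , _) =
    contradiction (ℕ.≤-trans (ℕ.≤-reflexive (trans (sym (totalLength-∷ʳ us _)) eq)) le)
      (ℕ.<⇒≱ (ℕ.≤-trans (s≤s z≤n) (ℕ.m≤n+m (2 ℕ.* suc b) (sum (map tileLength us)))))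
  go (suc f) d le ._ (us ∷ʳ′ doublebrick (suc b)) ((eq , dr) , br) =
    there (∈-concat⁺′ (∈-map⁺ (appendDouble b)
        (go f _ (shorter b le) us (initLast us)
          ((us≡ , AllPairs-init us dr) , subst (_≤ 1) (#bricks-doublebrick us (suc b)) br)))
      (∈-map⁺ (goodRowsBy f d) (∈-upTo⁺ (double≤⇒≤half
        (ℕ.≤-trans (ℕ.m≤n+m _ (sum (map tileLength us))) (ℕ.≤-reflexive total))))))
    where
    total : sum (map tileLength us) ℕ.+ 2 ℕ.* suc b ≡ d
    total = trans (sym (totalLength-∷ʳ us _)) eq
    us≡ : sum (map tileLength us) ≡ d ∸ 2 ℕ.* suc b
    us≡ = trans (sym (ℕ.m+n∸n≡m _ (2 ℕ.* suc b))) (cong (_∸ 2 ℕ.* suc b) total)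

-- Rows built from different `b` differ in their last tile, and `undoubledRow d` does not end in a
-- doublebrick.
goodRows-unique : ∀ f d → Unique (goodRows f d)
goodRows-unique zero    d = [] ∷ []
goodRows-unique (suc f) d = All.tabulate undoubled∉ ∷ Unique.concat⁺
  (All.map⁺ (All.universal (λ b →
    Unique.map⁺ (List.∷ʳ-injectiveˡ _ _) (goodRows-unique f _)) (upTo (d / 2))))
  (AllPairs.map⁺ (AllPairs.map disjoint (Unique.upTo⁺ (d / 2))))
  where
  undoubled≢ : ∀ d ts b → undoubledRow d ≢ appendDouble b ts
  undoubled≢ zero    []          b ()
  undoubled≢ zero    (_ ∷ _)     b ()
  undoubled≢ (suc d) []          b ()
  undoubled≢ (suc d) (_ ∷ [])    b ()
  undoubled≢ (suc d) (_ ∷ _ ∷ _) b ()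
  undoubled∉ : ∀ {ts} → ts ∈ concat (map (goodRowsBy f d) (upTo (d / 2))) → undoubledRow d ≢ ts
  undoubled∉ ts∈ eq
    with rs , ts∈rs , rs∈ ← ∈-concat⁻′ (map (goodRowsBy f d) (upTo (d / 2))) ts∈
    with b , b∈ , refl ← ∈-map⁻ (goodRowsBy f d) rs∈
    with us , us∈ , refl ← ∈-map⁻ (appendDouble b) ts∈rs
    = undoubled≢ d us b eq
  disjoint : ∀ {b c} → b ≢ c → ∀ {ts} → ¬ (ts ∈ goodRowsBy f d b × ts ∈ goodRowsBy f d c)
  disjoint {b} {c} b≢c (p , q)
    with us , _ , refl ← ∈-map⁻ (appendDouble b) p
    with vs , _ , eq ← ∈-map⁻ (appendDouble c) q
    with refl ← List.∷ʳ-injectiveʳ us vs eq = b≢c refl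

atMostOneBrick? : Decidable (λ ts → #bricks ts ≤ 1)
atMostOneBrick? ts = #bricks ts ℕ.≤? 1

rowSum : ∀ r .{{_ : NonZero r}} d m →
  ∑ (rowEnumeration d)
    (λ row → indicator (atMostOneBrick? (value row)) * rowTerm r m (value row)) ≡
  coeff (E⁺ d ⟨ r ⟩) m
rowSum r d m = begin
  ∑ (rowEnumeration d)
    (λ row → indicator (atMostOneBrick? (value row)) * rowTerm r m (value row))
    ≡⟨ sumOver-refine (isRow? d) candidates
         (λ ts → indicator (atMostOneBrick? ts) * rowTerm r m ts) ⟩
  ∑[ ts ∈ candidates ]
    (indicator (isRow? d ts) * (indicator (atMostOneBrick? ts) * rowTerm r m ts))
    ≡⟨ sumOver-cong candidates (λ ts → trans
         (sym (ℚ.*-assoc (indicator (isRow? d ts)) _ _))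
         (cong (_* rowTerm r m ts) (sym (indicator-× (isRow? d ts) (atMostOneBrick? ts))))) ⟩
  ∑[ ts ∈ candidates ] (indicator (isRow? d ts ×-dec atMostOneBrick? ts) * rowTerm r m ts)
    ≡⟨ sumOver-filtered (λ ts → isRow? d ts ×-dec atMostOneBrick? ts) (rowTerm r m)
         (listsUpTo-unique d (tilesUpTo-unique d)) (goodRows-unique d d)
         (λ ts∈ → let good = ∈-goodRows⁻ d d ts∈ in candidate (proj₁ good) , good)
         (λ _ good → ∈-goodRows⁺ d d ℕ.≤-refl good) ⟩
  sumOver (goodRows d d) (rowTerm r m)
    ≡⟨ goodRows-sum r d d ℕ.≤-refl m ⟩
  coeff (E⁺ d ⟨ r ⟩) m ∎
  where
  open ≡-Reasoning
  candidates = listsUpTo d (tilesUpTo d)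
  candidate : ∀ {ts} → IsRow d ts → ts ∈ candidates
  candidate {ts} p =
    ∈-refine⁻ (isRow? d) (Enumeration.complete (rowEnumeration d) (ts , [ p ]))

-- Sums over tabloids of arbitrary content

TabloidRows : List Block → Set
TabloidRows = All (Row ∘ degree)

tabloidRows : ∀ bs → Enumeration (TabloidRows bs)
tabloidRows = allEnumeration (rowEnumeration ∘ degree)

atMostOneBrickPerRow? : ∀ {bs} (T : TabloidRows bs) → Dec (All (λ ts → #bricks ts ≤ 1) (rows T))
atMostOneBrickPerRow? T = All.all? atMostOneBrick? (rows T)

-- The bound on the bricks is an indicator here instead of a restriction of the range, so that the
-- weight is multiplicative over the rows.
tabloidWeight : ∀ {bs} → TabloidRows bs → ℚ
tabloidWeight T = indicator (atMostOneBrickPerRow? T) * (- 1ℚ) ^ sum (map #doublebricks (rows T))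

tabloidWeight-∷ : ∀ {b bs} (row : Row (degree b)) (T : TabloidRows bs) →
  tabloidWeight {b ∷ bs} (row ∷ T) ≡
  indicator (atMostOneBrick? (value row)) * sign (value row) * tabloidWeight T
tabloidWeight-∷ {b} {bs} row T = trans
  (cong₂ _*_ (indicator-× (atMostOneBrick? (value row)) (atMostOneBrickPerRow? T))
    (^-homo-* (- 1ℚ) (#doublebricks (value row)) (sum (map #doublebricks (rows T)))))
  (*-interchange (indicator (atMostOneBrick? (value row))) (indicator (atMostOneBrickPerRow? T))
    (sign (value row)) _)

tabloidSum : ∀ bs m →
  ∑ (tabloidRows bs) (λ T → tabloidWeight T * coeff (blocksSeries H (content T)) m) ≡
  coeff (blocksSeries E⁺ bs) m
tabloidSum []               m = trans (ℚ.+-identityʳ _) (ℚ.*-identityˡ (coeff one m))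
tabloidSum (b@(block d r) ∷ bs) m = begin
  ∑ (tabloidRows (b ∷ bs)) (λ T → tabloidWeight T * coeff (blocksSeries H (content T)) m)
    ≡⟨ sumOver-product _∷_ Rs Ts _ ⟩
  ∑[ row ∈ Rs ] ∑[ T ∈ Ts ] (tabloidWeight {b ∷ bs} (row ∷ T) *
    coeff (blocksSeries H (map (tileBlock r) (value row) ++ content T)) m)
    ≡⟨ sumOver-cong Rs (λ row → trans (sumOver-cong Ts (λ T → split row T)) (inner row)) ⟩
  ∑[ row ∈ Rs ] (c row * coeff (F row · blocksSeries E⁺ bs) m)
    ≡⟨ ·-linearˡ Rs c F (blocksSeries E⁺ bs) m ⟩
  splitSum factorizations m (λ x y →
    ∑[ row ∈ Rs ] (c row * coeff (F row) x) * coeff (blocksSeries E⁺ bs) y)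
    ≡⟨ splitSum-cong factorizations m (λ x y → cong (_* coeff (blocksSeries E⁺ bs) y)
         (trans (sumOver-cong Rs (λ row →
             ℚ.*-assoc (indicator (atMostOneBrick? (value row))) _ _))
           (rowSum r d x))) ⟩
  coeff (blocksSeries E⁺ (b ∷ bs)) m ∎
  where
  open ≡-Reasoning
  Rs = Enumeration.elements (rowEnumeration d)
  Ts = Enumeration.elements (tabloidRows bs)
  c : Row d → ℚ
  c row = indicator (atMostOneBrick? (value row)) * sign (value row)
  F : Row d → PowerSeries
  F row = blocksSeries H (map (tileBlock r) (value row))
  -- The two factors are exchanged because `T` varies while `row` is fixed, and `·-linearˡ` sums
  -- over the left factor.
  split : ∀ row T →
    tabloidWeight {b ∷ bs} (row ∷ T) *
      coeff (blocksSeries H (map (tileBlock r) (value row) ++ content T)) m ≡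
    c row * (tabloidWeight T * coeff (blocksSeries H (content T) · F row) m)
  split row T = trans
    (cong₂ _*_ (tabloidWeight-∷ {b} {bs} row T)
      (trans (blocksSeries-++ H (map (tileBlock r) (value row)) (content T) m)
        (·-comm (F row) (blocksSeries H (content T)) m)))
    (ℚ.*-assoc (c row) (tabloidWeight T) _)
  inner : ∀ row →
    ∑[ T ∈ Ts ] (c row * (tabloidWeight T * coeff (blocksSeries H (content T) · F row) m)) ≡
    c row * coeff (F row · blocksSeries E⁺ bs) m
  inner row = trans (sumOver-*ˡ Ts (c row) _) (cong (c row *_) (begin
    ∑[ T ∈ Ts ] (tabloidWeight T * coeff (blocksSeries H (content T) · F row) m)
      ≡⟨ ·-linearˡ Ts tabloidWeight (λ T → blocksSeries H (content T)) (F row) m ⟩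
    splitSum factorizations m (λ x y →
      ∑[ T ∈ Ts ] (tabloidWeight T * coeff (blocksSeries H (content T)) x) * coeff (F row) y)
      ≡⟨ splitSum-cong factorizations m (λ x y → cong (_* coeff (F row) y) (tabloidSum bs x)) ⟩
    coeff (blocksSeries E⁺ bs · F row) m
      ≡⟨ ·-comm (blocksSeries E⁺ bs) (F row) m ⟩
    coeff (F row · blocksSeries E⁺ bs) m ∎))

-- Types as multisets of blocks

blockWeight : List Block → ℕ
blockWeight bs = sum (map (λ b → degree b ℕ.* multiplicity b) bs)

PositiveDegrees : List Block → Set
PositiveDegrees = All (NonZero ∘ degree)

blockWeight-++ : ∀ bs cs → blockWeight (bs ++ cs) ≡ blockWeight bs ℕ.+ blockWeight cs
blockWeight-++ bs cs = trans (cong sum (List.map-++ _ bs cs)) (sum-++ (map _ bs) _)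

blockWeight-↭ : ∀ {bs cs} → bs ↭ cs → blockWeight bs ≡ blockWeight cs
blockWeight-↭ p = sum-↭ (map⁺ _ p)

blockWeight-blocksFrom : ∀ k .{{_ : NonZero k}} ps →
                         blockWeight (blocksFrom k ps) ≡ weight k (map size ps)
blockWeight-blocksFrom k []       = refl
blockWeight-blocksFrom k (p ∷ ps) = trans
  (blockWeight-++ (map (λ d → block d k) (value p)) (blocksFrom (suc k) ps))
  (cong₂ ℕ._+_ (parts (value p)) (blockWeight-blocksFrom (suc k) ps))
  where
  parts : ∀ ds → blockWeight (map (λ d → block d k) ds) ≡ k ℕ.* sum ds
  parts []       = sym (ℕ.*-zeroʳ k)
  parts (d ∷ ds) = trans (cong₂ ℕ._+_ (ℕ.*-comm d k) (parts ds))
    (sym (ℕ.*-distribˡ-+ k d (sum ds)))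

isPartition : (p : Partition) → IsPartition (value p)
isPartition (ps , pf) = extract (isPartition? ps) pf

blocksFrom-positive : ∀ k .{{_ : NonZero k}} ps → PositiveDegrees (blocksFrom k ps)
blocksFrom-positive k []       = []
blocksFrom-positive k (p ∷ ps) =
  All.++⁺ (All.map⁺ (proj₁ (isPartition p))) (blocksFrom-positive (suc k) ps)

blockWeight-blocks : ∀ {n} (τ : Typ n) → blockWeight (blocks τ) ≡ n
blockWeight-blocks (v , eq) =
  trans (blockWeight-blocksFrom 1 (toList v)) (extract (_ ℕ.≟ _) eq)

blockWeight-tileBlocks : ∀ r .{{_ : NonZero r}} ts →
  blockWeight (map (tileBlock r) ts) ≡ sum (map tileLength ts) ℕ.* r
blockWeight-tileBlocks r []                   = refl
blockWeight-tileBlocks r (brick a ∷ ts)       = trans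
  (cong (a ℕ.* r ℕ.+_) (blockWeight-tileBlocks r ts))
  (sym (ℕ.*-distribʳ-+ r a (sum (map tileLength ts))))
blockWeight-tileBlocks r (doublebrick b ∷ ts) = trans
  (cong₂ ℕ._+_ (rearrange b r) (blockWeight-tileBlocks r ts))
  (sym (ℕ.*-distribʳ-+ r (2 ℕ.* b) (sum (map tileLength ts))))
  where
  rearrange : ∀ b r → b ℕ.* (2 ℕ.* r) ≡ 2 ℕ.* b ℕ.* r
  rearrange = ℕ-Ring.solve-∀

blockWeight-content : ∀ {bs} (T : TabloidRows bs) → blockWeight (content T) ≡ blockWeight bs
blockWeight-content []                                = refl
blockWeight-content {block d r ∷ bs} ((ts , row) ∷ T) = trans
  (blockWeight-++ (map (tileBlock r) ts) (content T))
  (cong₂ ℕ._+_ (trans (blockWeight-tileBlocks r ts)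
    (cong (ℕ._* r) (proj₁ (extract (isRow? d ts) row)))) (blockWeight-content T))

content-positive : ∀ {bs} (T : TabloidRows bs) → PositiveDegrees (content T)
content-positive []                                = []
content-positive {block d r ∷ bs} ((ts , row) ∷ T) =
  All.++⁺ (All.map⁺ (All.universal positive ts)) (content-positive T)
  where
  positive : ∀ t → NonZero (degree (tileBlock r t))
  positive (brick (suc _))       = _
  positive (doublebrick (suc _)) = _

insertPart : ∀ d → .{{NonZero d}} → Partition → Partition
insertPart d (ps , [ pf ]) = insert d ps ,
  [ All-resp-↭ (Perm.↭-sym (insert-↭ d ps)) (ℕ.≢-nonZero (ℕ.≢-nonZero⁻¹ d) ∷ proj₁ pf)
  , insert-↗ d (proj₂ pf) ]

block-cong : ∀ d k .{{_ : NonZero k}} r .{{_ : NonZero r}} → k ≡ r → block d k ≡ block d r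
block-cong d k r refl = refl

updateAt-blocksFrom : ∀ k .{{_ : NonZero k}} {N} (v : Vec Partition N) i
  d .{{_ : NonZero d}} r .{{_ : NonZero r}} → k ℕ.+ toℕ i ≡ r →
  blocksFrom k (toList (Vec.updateAt v i (insertPart d))) ↭ block d r ∷ blocksFrom k (toList v)
updateAt-blocksFrom k (p ∷ v) Fin.zero d r eq = subst
  (λ b → blocksFrom k (insertPart d p ∷ toList v) ↭ b ∷ blocksFrom k (p ∷ toList v))
  (block-cong d k r (trans (sym (ℕ.+-identityʳ k)) eq))
  (++⁺ʳ (blocksFrom (suc k) (toList v)) (map⁺ (λ e → block e k) (insert-↭ d (value p))))
updateAt-blocksFrom k (p ∷ v) (Fin.suc i) d r eq = Perm.trans
  (++⁺ˡ (map (λ e → block e k) (value p))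
    (updateAt-blocksFrom (suc k) v i d r (trans (sym (ℕ.+-suc k (toℕ i))) eq)))
  (shift (block d r) (map (λ e → block e k) (value p)) (blocksFrom (suc k) (toList v)))

vecOfBlocks : ∀ N bs → PositiveDegrees bs → All (λ b → multiplicity b ≤ N) bs →
              ∃ λ (v : Vec Partition N) → blocksFrom 1 (toList v) ↭ bs
vecOfBlocks N [] [] [] = replicate N ([] , [ [] , [] ]) , Perm.↭-reflexive (empty 1 N)
  where
  empty : ∀ k .{{_ : NonZero k}} N → blocksFrom k (toList (replicate N ([] , [ [] , [] ]))) ≡ []
  empty k zero    = refl
  empty k (suc N) = empty (suc k) N
vecOfBlocks N (block d (suc r) ∷ bs) (d≢0 ∷ pos) (r<N ∷ les)
  with v , p ← vecOfBlocks N bs pos les =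
  Vec.updateAt v (fromℕ< r<N) (insertPart d {{d≢0}}) , Perm.trans
    (updateAt-blocksFrom 1 v (fromℕ< r<N) d {{d≢0}} (suc r) (cong suc (Fin.toℕ-fromℕ< r<N)))
    (Perm.prep _ p)

-- A block of positive degree weighs at least its multiplicity. Hence the n partitions stored in a
-- type of n have room for every block.
multiplicity≤blockWeight : ∀ bs → PositiveDegrees bs →
                           All (λ b → multiplicity b ≤ blockWeight bs) bs
multiplicity≤blockWeight []             []          = []
multiplicity≤blockWeight (block d r ∷ bs) (d≢0 ∷ pos) =
  ℕ.≤-trans (ℕ.m≤n*m r d {{d≢0}}) (ℕ.m≤m+n _ _) ∷
  All.map (λ le → ℕ.≤-trans le (ℕ.m≤n+m _ (d ℕ.* r))) (multiplicity≤blockWeight bs pos)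

typeOfBlocks : ∀ {n} bs → PositiveDegrees bs → blockWeight bs ≡ n →
               ∃ λ (τ : Typ n) → blocks τ ↭ bs
typeOfBlocks bs pos refl
  with v , p ← vecOfBlocks (blockWeight bs) bs pos (multiplicity≤blockWeight bs pos) =
  (v , [ trans (sym (blockWeight-blocksFrom 1 (toList v))) (blockWeight-↭ p) ]) , p

blocksFrom-multiplicity : ∀ k .{{_ : NonZero k}} ps →
                          All (λ b → k ≤ multiplicity b) (blocksFrom k ps)
blocksFrom-multiplicity k []       = []
blocksFrom-multiplicity k (p ∷ ps) = All.++⁺
  (All.map⁺ (All.universal (λ _ → ℕ.≤-refl) (value p)))
  (All.map (ℕ.≤-trans (ℕ.n≤1+n k)) (blocksFrom-multiplicity (suc k) ps))

module _ (k : ℕ) .{{_ : NonZero k}} where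

  hasMultiplicity? : Decidable (λ b → multiplicity b ≡ k)
  hasMultiplicity? b = multiplicity b ℕ.≟ k

  private
    firsts : ∀ ds → All (λ b → multiplicity b ≡ k) (map (λ d → block d k) ds)
    firsts ds = All.map⁺ (All.universal (λ _ → refl) ds)

    others : ∀ ps → All (λ b → multiplicity b ≢ k) (blocksFrom (suc k) ps)
    others ps = All.map (λ lt eq → ℕ.<-irrefl (sym eq) lt) (blocksFrom-multiplicity (suc k) ps)

  filter-blocksFrom : ∀ p ps →
    filter hasMultiplicity? (blocksFrom k (p ∷ ps)) ≡ map (λ d → block d k) (value p)
  filter-blocksFrom p ps = trans (List.filter-++ hasMultiplicity? (map _ (value p)) _)
    (trans (cong₂ _++_ (List.filter-all hasMultiplicity? (firsts (value p)))
        (List.filter-none hasMultiplicity? (others ps)))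
      (List.++-identityʳ _))

  filter-¬-blocksFrom : ∀ p ps →
    filter (¬? ∘ hasMultiplicity?) (blocksFrom k (p ∷ ps)) ≡ blocksFrom (suc k) ps
  filter-¬-blocksFrom p ps = trans (List.filter-++ (¬? ∘ hasMultiplicity?) (map _ (value p)) _)
    (cong₂ _++_
      (List.filter-none (¬? ∘ hasMultiplicity?) (All.map (λ eq ¬eq → ¬eq eq) (firsts (value p))))
      (List.filter-all (¬? ∘ hasMultiplicity?) (others ps)))

partition-↭⇒≡ : ∀ (p q : Partition) → value p ↭ value q → p ≡ q
partition-↭⇒≡ p q p↭q = value-injective (Pointwise-≡⇒≡
  (↗↭↗⇒≋ (DecTotalOrder.totalOrder ≥-decTotalOrder)
    (proj₂ (isPartition p)) (proj₂ (isPartition q)) (↭⇒↭ₛ p↭q)))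

-- The first partition supplies exactly the blocks of multiplicity `k`, since all later ones have
-- larger multiplicity. Filtering thus peels off one partition at a time, and a weakly decreasing
-- list is determined by its multiset of parts.
blocksFrom-injective : ∀ k .{{_ : NonZero k}} {N} (v w : Vec Partition N) →
  blocksFrom k (toList v) ↭ blocksFrom k (toList w) → v ≡ w
blocksFrom-injective k []      []      _ = refl
blocksFrom-injective k (p ∷ v) (q ∷ w) r = cong₂ _∷_
  (partition-↭⇒≡ p q (subst₂ _↭_ (degrees (value p)) (degrees (value q))
    (map⁺ degree (subst₂ _↭_ (filter-blocksFrom k p (toList v)) (filter-blocksFrom k q (toList w))
      (filter-↭ (hasMultiplicity? k) r)))))
  (blocksFrom-injective (suc k) v w
    (subst₂ _↭_ (filter-¬-blocksFrom k p (toList v)) (filter-¬-blocksFrom k q (toList w))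
      (filter-↭ (¬? ∘ hasMultiplicity? k) r)))
  where
  degrees : ∀ ds → map degree (map (λ d → block d k) ds) ≡ ds
  degrees ds = trans (sym (List.map-∘ ds)) (List.map-id ds)

blocks-injective : ∀ {n} (τ τ′ : Typ n) → blocks τ ↭ blocks τ′ → τ ≡ τ′
blocks-injective τ τ′ p = value-injective (blocksFrom-injective 1 (value τ) (value τ′) p)

-- Grouping the tabloids by content

E⁺-expansion : ∀ {n} (σ : Typ n) →
  IsExpansion (H ⟦_⟧) (E⁺ ⟦ σ ⟧) (λ ρ → ∑ (tabloids σ ρ) (λ T → (- 1ℚ) ^ ℓ₂ σ ρ T))
E⁺-expansion {n} σ m = begin
  coeff (E⁺ ⟦ σ ⟧) m
    ≡⟨ tabloidSum (blocks σ) m ⟨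
  ∑[ T ∈ Ts ] (tabloidWeight T * h (content T))
    -- A factor 1 is inserted as the number of types whose blocks are the content of `T`;
    -- interchanging the sums then collects the tabloids of each type.
    ≡⟨ sumOver-cong Ts (λ T → trans (sym (ℚ.*-identityˡ _)) (trans
         (cong (_* (tabloidWeight T * h (content T))) (sym (uniqueType T)))
         (sym (sumOver-*ʳ ρs (λ ρ → indicator (content T ↭? blocks ρ)) _)))) ⟩
  ∑[ T ∈ Ts ] ∑[ ρ ∈ ρs ] (indicator (content T ↭? blocks ρ) * (tabloidWeight T * h (content T)))
    ≡⟨ sumOver-cong Ts (λ T → sumOver-cong ρs (λ ρ → regroup T ρ)) ⟩
  ∑[ T ∈ Ts ] ∑[ ρ ∈ ρs ] (indicator (isTabloid? T ρ) * s T * h (blocks ρ))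
    ≡⟨ sumOver-swap Ts ρs _ ⟩
  ∑[ ρ ∈ ρs ] ∑[ T ∈ Ts ] (indicator (isTabloid? T ρ) * s T * h (blocks ρ))
    ≡⟨ sumOver-cong ρs (λ ρ → trans
         (sumOver-*ʳ Ts (λ T → indicator (isTabloid? T ρ) * s T) (h (blocks ρ)))
         (cong (_* h (blocks ρ)) (sym (sumOver-refine (λ T → isTabloid? T ρ) Ts s)))) ⟩
  ∑ (types n) (λ ρ → ∑ (tabloids σ ρ) (λ T → (- 1ℚ) ^ ℓ₂ σ ρ T) * coeff (H ⟦ ρ ⟧) m) ∎
  where
  open ≡-Reasoning
  Ts = Enumeration.elements (tabloidRows (blocks σ))
  ρs = Enumeration.elements (types n)
  h : List Block → ℚ
  h bs = coeff (blocksSeries H bs) m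
  s : TabloidRows (blocks σ) → ℚ
  s T = (- 1ℚ) ^ sum (map #doublebricks (rows T))
  isTabloid? : ∀ T ρ → Dec (content T ↭ blocks ρ × All (λ ts → #bricks ts ≤ 1) (rows T))
  isTabloid? T ρ = (content T ↭? blocks ρ) ×-dec atMostOneBrickPerRow? T
  uniqueType : ∀ T → ∑[ ρ ∈ ρs ] indicator (content T ↭? blocks ρ) ≡ 1ℚ
  uniqueType T = sumOver-indicator (λ ρ → content T ↭? blocks ρ) (yes tt)
    (Enumeration.unique (types n))
    (λ {ρ} {ρ′} _ _ p q → blocks-injective ρ ρ′ (Perm.trans (Perm.↭-sym p) q))
    (λ _ → let ρ , p = typeOfBlocks (content T) (content-positive T)
                         (trans (blockWeight-content T) (blockWeight-blocks σ))
           in ρ , Enumeration.complete (types n) ρ , Perm.↭-sym p)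
    (λ _ _ → tt)
  regroup : ∀ T ρ →
    indicator (content T ↭? blocks ρ) * (tabloidWeight T * h (content T)) ≡
    indicator (isTabloid? T ρ) * s T * h (blocks ρ)
  regroup T ρ = begin
    i * (j * s T * h (content T))
      ≡⟨ indicator-*-cong (content T ↭? blocks ρ) (λ p →
           cong (j * s T *_) (blocksSeries-↭ H p m)) ⟩
    i * (j * s T * h (blocks ρ))
      ≡⟨ ℚ.*-assoc i (j * s T) (h (blocks ρ)) ⟨
    i * (j * s T) * h (blocks ρ)
      ≡⟨ cong (_* h (blocks ρ)) (trans (sym (ℚ.*-assoc i j (s T)))
           (cong (_* s T) (sym (indicator-× (content T ↭? blocks ρ) (atMostOneBrickPerRow? T))))) ⟩
    indicator (isTabloid? T ρ) * s T * h (blocks ρ) ∎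
    where
    i = indicator (content T ↭? blocks ρ)
    j = indicator (atMostOneBrickPerRow? T)

-- Terms of lowest total exponent

total : Monomial → ℕ
total m = sum (map sum m)

atomsRow : ℕ → List ℕ → List Block
atomsRow d []           = []
atomsRow d (zero ∷ es)  = atomsRow d es
atomsRow d (suc e ∷ es) = block d (suc e) ∷ atomsRow d es

-- The blocks iʳ for the variables x_{i,j} of positive exponent r, when the rows
-- are numbered from k on.
atoms : ℕ → Monomial → List Block
atoms k []        = []
atoms k (row ∷ m) = atomsRow k row ++ atoms (suc k) m

multiplicities : List Block → ℕ
multiplicities bs = sum (map multiplicity bs)

multiplicities-++ : ∀ bs cs →
  multiplicities (bs ++ cs) ≡ multiplicities bs ℕ.+ multiplicities cs
multiplicities-++ bs cs =
  trans (cong sum (List.map-++ multiplicity bs cs)) (sum-++ (map multiplicity bs) _)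

multiplicities-↭ : ∀ {bs cs} → bs ↭ cs → multiplicities bs ≡ multiplicities cs
multiplicities-↭ p = sum-↭ (map⁺ multiplicity p)

multiplicities-atoms : ∀ k m → multiplicities (atoms k m) ≡ total m
multiplicities-atoms k []        = refl
multiplicities-atoms k (row ∷ m) = trans
  (multiplicities-++ (atomsRow k row) (atoms (suc k) m))
  (cong₂ ℕ._+_ (inRow row) (multiplicities-atoms (suc k) m))
  where
  inRow : ∀ es → multiplicities (atomsRow k es) ≡ sum es
  inRow []           = refl
  inRow (zero ∷ es)  = inRow es
  inRow (suc e ∷ es) = cong (suc e ℕ.+_) (inRow es)

length≤multiplicities : ∀ bs → length bs ≤ multiplicities bs
length≤multiplicities []                   = z≤n
length≤multiplicities (block d (suc r) ∷ bs) =
  s≤s (ℕ.≤-trans (length≤multiplicities bs) (ℕ.m≤n+m _ r))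

total-split : ∀ {x y m} → Factors x y m → total x ℕ.+ total y ≡ total m
total-split []       = refl
total-split (_∷_ {a} {b} {e} {as} {bs} r rs) = trans
  (rearrange (sum a) (total as) (sum b) (total bs))
  (cong₂ ℕ._+_ (sum-split r) (total-split rs))
  where
  rearrange : ∀ a s b t → a ℕ.+ s ℕ.+ (b ℕ.+ t) ≡ a ℕ.+ b ℕ.+ (s ℕ.+ t)
  rearrange = ℕ-Ring.solve-∀

total≡0⇒AllExp≡0 : ∀ m → total m ≡ 0 → AllExp (_≡ 0) m
total≡0⇒AllExp≡0 []        _  = []
total≡0⇒AllExp≡0 (row ∷ m) eq =
  sum≡0⇒All≡0 row (ℕ.m+n≡0⇒m≡0 (sum row) eq) ∷ total≡0⇒AllExp≡0 m (ℕ.m+n≡0⇒n≡0 (sum row) eq)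

m+n≡m⇒n≡0 : ∀ {m n} → m ℕ.+ n ≡ m → n ≡ 0
m+n≡m⇒n≡0 {m} eq = ℕ.+-cancelˡ-≡ m _ _ (trans eq (sym (ℕ.+-identityʳ m)))

rowSplit-zero : ∀ {as bs es} → RowSplit as bs es → sum as ≡ 0 → es ≡ bs
rowSplit-zero []                           _  = refl
rowSplit-zero (_∷_ {zero} refl rs)         eq = cong (_ ∷_) (rowSplit-zero rs eq)

factors-zero : ∀ {x y m} → Factors x y m → total x ≡ 0 → m ≡ y
factors-zero []                 _  = refl
factors-zero (_∷_ {a = a} r rs) eq =
  cong₂ _∷_ (rowSplit-zero r (ℕ.m+n≡0⇒m≡0 (sum a) eq)) (factors-zero rs (ℕ.m+n≡0⇒n≡0 (sum a) eq))

-- What multiplication by a power of one variable does to the atoms `bs`: a new variable contributes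
-- the block `b`, whereas a variable already present leaves their number as it was.
Extends : Block → List Block → List Block → Set
Extends b as bs = as ↭ b ∷ bs ⊎ length as ≤ length bs

extends-++ˡ : ∀ {b as bs} cs → Extends b as bs → Extends b (cs ++ as) (cs ++ bs)
extends-++ˡ {b} {as} {bs} cs (inj₁ p)  = inj₁ (Perm.trans (++⁺ˡ cs p) (shift b cs bs))
extends-++ˡ {b} {as} {bs} cs (inj₂ le) = inj₂
  (subst₂ _≤_ (sym (List.length-++ cs)) (sym (List.length-++ cs)) (ℕ.+-monoʳ-≤ (length cs) le))

extends-++ʳ : ∀ {b as bs} cs → Extends b as bs → Extends b (as ++ cs) (bs ++ cs)
extends-++ʳ {b} {as} {bs} cs (inj₁ p)  = inj₁ (++⁺ʳ cs p)
extends-++ʳ {b} {as} {bs} cs (inj₂ le) = inj₂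
  (subst₂ _≤_ (sym (List.length-++ as)) (sym (List.length-++ bs)) (ℕ.+-monoˡ-≤ (length cs) le))

divisor-bounded : ∀ {r e} .{{_ : NonZero e}} → r ∣ e → e ≤ r → e ≡ r
divisor-bounded r∣e e≤r = ℕ.≤-antisym e≤r (∣⇒≤ r∣e)

-- Multiples of `r` with sum `r` are all 0 except for a single `r`. The alternative depends on
-- whether the variable at that place occurs in `bs`.
atomsRow-extends : ∀ d r .{{_ : NonZero r}} {as bs es} → RowSplit as bs es →
  All (r ∣_) as → sum as ≡ r → Extends (block d r) (atomsRow d es) (atomsRow d bs)
atomsRow-extends d r []                               []       eq =
  contradiction (sym eq) (ℕ.≢-nonZero⁻¹ r)
atomsRow-extends d r (_∷_ {zero} {zero} refl rs)      (_ ∷ ps) eq = atomsRow-extends d r rs ps eq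
atomsRow-extends d r (_∷_ {zero} {suc b} refl rs)     (_ ∷ ps) eq =
  extends-++ˡ (block d (suc b) ∷ []) (atomsRow-extends d r rs ps eq)
atomsRow-extends d r (_∷_ {suc a} {b} {as = as} {bs} {es} refl rs) (p ∷ ps) eq
  with refl ← divisor-bounded p (ℕ.≤-trans (ℕ.m≤m+n (suc a) (sum as)) (ℕ.≤-reflexive eq))
  with refl ← rowSplit-zero rs (m+n≡m⇒n≡0 eq)
  = last b
  where
  last : ∀ b → Extends (block d (suc a)) (atomsRow d ((suc a ℕ.+ b) ∷ es)) (atomsRow d (b ∷ es))
  last zero    rewrite ℕ.+-identityʳ a = inj₁ Perm.↭-refl
  last (suc b) = inj₂ ℕ.≤-refl

-- The row sums of `x` are multiples of `r` with sum `r`, so one row carries everything; comparing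
-- weights shows that its number is `d`.
atoms-extends : ∀ k d r .{{_ : NonZero r}} {x y m} → Factors x y m → AllExp (r ∣_) x →
  total x ≡ r → weight k (map sum x) ≡ r ℕ.* d → Extends (block d r) (atoms k m) (atoms k y)
atoms-extends k d r [] [] tot _ = contradiction (sym tot) (ℕ.≢-nonZero⁻¹ r)
atoms-extends k d r (_∷_ {a} {b} {e} {as} {bs} {es} s ss) (p ∷ ps) tot w with sum a in sum≡
... | zero  rewrite rowSplit-zero s sum≡ =
  extends-++ˡ (atomsRow k b) (atoms-extends (suc k) d r ss ps tot
    (trans (cong (ℕ._+ weight (suc k) (map sum as)) (sym (ℕ.*-zeroʳ k))) w))
... | suc c
  with refl ← divisor-bounded
         (subst (r ∣_) sum≡ (subst (r ∣_) (sym (sum-root r p)) (m∣m*n _)))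
         (ℕ.≤-trans (ℕ.m≤m+n (suc c) (total as)) (ℕ.≤-reflexive tot))
  with refl ← factors-zero ss (m+n≡m⇒n≡0 tot)
  with refl ← ℕ.*-cancelˡ-≡ k d (suc c) (trans (ℕ.*-comm (suc c) k) (trans (sym (trans
      (cong (k ℕ.* suc c ℕ.+_) (AllExp≡0⇒weight≡0 (suc k) (total≡0⇒AllExp≡0 as (m+n≡m⇒n≡0 tot))))
      (ℕ.+-identityʳ (k ℕ.* suc c)))) w))
  = extends-++ʳ (atoms (suc k) es) (atomsRow-extends k (suc c) s p sum≡)

sumOver-≢0 : ∀ (xs : List A) (f : A → ℚ) → sumOver xs f ≢ 0ℚ → ∃ λ x → x ∈ xs × f x ≢ 0ℚ
sumOver-≢0 []       f ≢0 = contradiction refl ≢0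
sumOver-≢0 (x ∷ xs) f ≢0 with f x ℚ.≟ 0ℚ
... | no fx≢0 = x , here refl , fx≢0
... | yes fx≡0 with y , y∈ , fy≢0 ← sumOver-≢0 xs f
                     (λ eq → ≢0 (trans (cong₂ _+_ fx≡0 eq) (ℚ.+-identityˡ 0ℚ))) =
  y , there y∈ , fy≢0

indicator-≢0 : ∀ {P : Set} (P? : Dec P) → indicator P? ≢ 0ℚ → P
indicator-≢0 (yes p) _  = p
indicator-≢0 (no _)  ≢0 = contradiction refl ≢0

coeff-H-≢0 : ∀ d r .{{_ : NonZero r}} m → coeff (H d ⟨ r ⟩) m ≢ 0ℚ →
             AllExp (r ∣_) m × deg m ≡ r ℕ.* d
coeff-H-≢0 d r m ≢0 = indicator-≢0 (power? r m ×-dec (deg m ℕ.≟ r ℕ.* d))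
  (λ eq → ≢0 (trans (coeff-H d r m)
    (trans (sym (indicator-× (power? r m) (deg m ℕ.≟ r ℕ.* d))) eq)))

r∣total : ∀ r .{{_ : NonZero r}} {m} → AllExp (r ∣_) m → r ∣ total m
r∣total r []                        = r ∣0
r∣total r (_∷_ {row} {m} ds dss) with divides q eq ← r∣total r dss =
  divides (sum (map (_/ r) row) ℕ.+ q)
  (trans (cong₂ ℕ._+_ (trans (sum-root r ds) (ℕ.*-comm r _)) eq)
    (sym (ℕ.*-distribʳ-+ r (sum (map (_/ r) row)) q)))

-- The total exponent is a multiple of `r`, and positivity of the degree excludes the monomial 1.
power≤total : ∀ d .{{_ : NonZero d}} r .{{_ : NonZero r}} {x} →
              AllExp (r ∣_) x → deg x ≡ r ℕ.* d → r ≤ total x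
power≤total d r {x} ps w = ∣⇒≤ {{ℕ.≢-nonZero total≢0}} (r∣total r ps)
  where
  total≢0 : total x ≢ 0
  total≢0 eq = ℕ.≢-nonZero⁻¹ (r ℕ.* d) {{ℕ.m*n≢0 r d}}
    (trans (sym w) (AllExp≡0⇒weight≡0 1 (total≡0⇒AllExp≡0 x eq)))

-- In H_{dʳ} the monomials x_{d,j}ʳ have total exponent r and all others have a
-- larger one. Hence the terms of H_{bs} of lowest total exponent are products of
-- such powers, and the number of variables drops when two of these collide.
data Subordinate (bs : List Block) (m : Monomial) : Set where
  smaller-total : multiplicities bs < total m → Subordinate bs m
  more-blocks   : multiplicities bs ≡ total m → length (atoms 1 m) < length bs → Subordinate bs m
  equal         : atoms 1 m ↭ bs → Subordinate bs m

-- A non-zero coefficient of the product comes from a factorization of `m` into `x` and `y` with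
-- both coefficients non-zero. The induction applies to `y`, and `x` has total exponent at least
-- `r`, with equality only for the power of one variable.
subordinate : ∀ bs m → PositiveDegrees bs → coeff (blocksSeries H bs) m ≢ 0ℚ → Subordinate bs m
subordinate [] m _ ≢0 =
  equal (Perm.↭-reflexive (noAtoms 1 (indicator-≢0 (All.all? (All.all? (ℕ._≟ 0)) m) ≢0)))
  where
  inRow : ∀ k {es} → All (_≡ 0) es → atomsRow k es ≡ []
  inRow k []          = refl
  inRow k (refl ∷ ps) = inRow k ps
  noAtoms : ∀ k {m} → AllExp (_≡ 0) m → atoms k m ≡ []
  noAtoms k []       = refl
  noAtoms k (p ∷ ps) = cong₂ _++_ (inRow k p) (noAtoms (suc k) ps)
subordinate (block d r ∷ bs) m (d≢0 ∷ pos) ≢0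
  with (x , y) , xy∈ , prod≢0 ← sumOver-≢0 (factorizations m)
         (λ p → coeff (H d ⟨ r ⟩) (proj₁ p) * coeff (blocksSeries H bs) (proj₂ p)) ≢0
  = conclude (∈-factorizations⁻ xy∈)
      (coeff-H-≢0 d r x (λ eq → prod≢0 (trans
        (cong (_* coeff (blocksSeries H bs) y) eq) (ℚ.*-zeroˡ (coeff (blocksSeries H bs) y)))))
      (subordinate bs y pos (λ eq → prod≢0 (trans
        (cong (coeff (H d ⟨ r ⟩) x *_) eq) (ℚ.*-zeroʳ (coeff (H d ⟨ r ⟩) x)))))
  where
  instance
    d-nonZero : NonZero d
    d-nonZero = d≢0
  conclude : ∀ {x y} → Factors x y m → AllExp (r ∣_) x × deg x ≡ r ℕ.* d →
             Subordinate bs y → Subordinate (block d r ∷ bs) m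
  conclude {x} {y} xy (ps , w) sub with ℕ.m≤n⇒m<n∨m≡n (power≤total d r ps w) | sub
  ... | inj₁ r< | s = smaller-total
    (ℕ.<-≤-trans (ℕ.+-mono-<-≤ r< (multiplicities≤ s)) (ℕ.≤-reflexive (total-split xy)))
    where
    multiplicities≤ : Subordinate bs y → multiplicities bs ≤ total y
    multiplicities≤ (smaller-total lt)  = ℕ.<⇒≤ lt
    multiplicities≤ (more-blocks eq _)  = ℕ.≤-reflexive eq
    multiplicities≤ (equal p)           =
      ℕ.≤-reflexive (trans (sym (multiplicities-↭ p)) (multiplicities-atoms 1 y))
  ... | inj₂ r≡ | smaller-total lt = smaller-total
    (ℕ.<-≤-trans (ℕ.+-mono-≤-< (ℕ.≤-reflexive r≡) lt) (ℕ.≤-reflexive (total-split xy)))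
  -- One power adds at most one variable, so a deficit of variables in `y` persists in `m`.
  ... | inj₂ r≡ | more-blocks eq lt =
    more-blocks (trans (cong₂ ℕ._+_ r≡ eq) (total-split xy))
      (s≤s (ℕ.≤-trans (atoms≤ (atoms-extends 1 d r xy ps (sym r≡) w)) lt))
    where
    atoms≤ : Extends (block d r) (atoms 1 m) (atoms 1 y) →
             length (atoms 1 m) ≤ suc (length (atoms 1 y))
    atoms≤ (inj₁ p)  = ℕ.≤-reflexive (↭-length p)
    atoms≤ (inj₂ le) = ℕ.m≤n⇒m≤1+n le
  ... | inj₂ r≡ | equal p with atoms-extends 1 d r xy ps (sym r≡) w
  ...   | inj₁ q  = equal (Perm.trans q (Perm.prep _ p))
  -- The new power collides with a variable of `y`: there is one block more but no variable more.
  ...   | inj₂ le = more-blocks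
    (trans (cong₂ ℕ._+_ r≡ (trans (sym (multiplicities-↭ p)) (multiplicities-atoms 1 y)))
      (total-split xy))
    (s≤s (ℕ.≤-trans le (ℕ.≤-reflexive (↭-length p))))

-- Positivity of the diagonal

sumOver-nonNegative : ∀ (xs : List A) (f : A → ℚ) → (∀ x → NonNegative (f x)) →
                      NonNegative (sumOver xs f)
sumOver-nonNegative []       f nn = _
sumOver-nonNegative (x ∷ xs) f nn =
  ℚ.nonNeg+nonNeg⇒nonNeg (f x) {{nn x}} (sumOver xs f) {{sumOver-nonNegative xs f nn}}

sumOver-positive : ∀ {xs : List A} {x} (f : A → ℚ) → (∀ y → NonNegative (f y)) →
                   x ∈ xs → Positive (f x) → Positive (sumOver xs f)
sumOver-positive {xs = x ∷ xs} f nn (here refl) pos =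
  ℚ.pos+nonNeg⇒pos (f x) {{pos}} (sumOver xs f) {{sumOver-nonNegative xs f nn}}
sumOver-positive {xs = x ∷ xs} f nn (there y∈) pos =
  ℚ.nonNeg+pos⇒pos (f x) {{nn x}} (sumOver xs f) {{sumOver-positive f nn y∈ pos}}

indicator-nonNegative : ∀ {P : Set} (P? : Dec P) → NonNegative (indicator P?)
indicator-nonNegative (yes _) = _
indicator-nonNegative (no _)  = _

H-nonNegative : ∀ d r .{{_ : NonZero r}} m → NonNegative (coeff (H d ⟨ r ⟩) m)
H-nonNegative d r m = subst NonNegative
  (trans (indicator-× (power? r m) (deg m ℕ.≟ r ℕ.* d)) (sym (coeff-H d r m)))
  (indicator-nonNegative (power? r m ×-dec (deg m ℕ.≟ r ℕ.* d)))

blocksSeries-H-nonNegative : ∀ bs m → NonNegative (coeff (blocksSeries H bs) m)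
blocksSeries-H-nonNegative []               m =
  indicator-nonNegative (All.all? (All.all? (ℕ._≟ 0)) m)
blocksSeries-H-nonNegative (block d r ∷ bs) m =
  sumOver-nonNegative (factorizations m) _ λ (x , y) →
  ℚ.nonNeg*nonNeg⇒nonNeg (coeff (H d ⟨ r ⟩) x) {{H-nonNegative d r x}}
    (coeff (blocksSeries H bs) y) {{blocksSeries-H-nonNegative bs y}}

-- The factorization that witnesses positivity: its first factor is to be the full power of the
-- first variable in `m`. The fields record what the coefficient of H at `power` and the induction
-- on `rest` ask for.
record FirstAtom (k : ℕ) (m : Monomial) (b : Block) (bs : List Block) : Set where
  field
    {power rest} : Monomial
    factors      : Factors power rest m
    powers       : AllExp (multiplicity b ∣_) power
    powerWeight  : weight k (map sum power) ≡ multiplicity b ℕ.* degree b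
    restAtoms    : atoms k rest ≡ bs

zeroRow : ∀ (es : List ℕ) → ∃ λ zs → RowSplit zs es es × All (_≡ 0) zs
zeroRow []       = [] , [] , []
zeroRow (e ∷ es) with zs , s , ps ← zeroRow es = 0 ∷ zs , refl ∷ s , refl ∷ ps

zeroFactor : ∀ m → ∃ λ z → Factors z m m × AllExp (_≡ 0) z
zeroFactor []        = [] , [] , []
zeroFactor (row ∷ m) with z , s , ps ← zeroRow row | zs , ss , pss ← zeroFactor m =
  z ∷ zs , s ∷ ss , ps ∷ pss

zeros-divisible : ∀ r {es} → All (_≡ 0) es → All (r ∣_) es
zeros-divisible r = All.map λ { refl → r ∣0 }

firstAtom : ∀ k m {b bs} → atoms k m ≡ b ∷ bs → FirstAtom k m b bs
-- The first row is kept apart as `p` and `q` because skipping a zero exponent prepends a 0 to both.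
firstAtomRow : ∀ k row m {b bs} → atoms k (row ∷ m) ≡ b ∷ bs →
  ∃₂ λ p q → ∃₂ λ ps qs → RowSplit p q row × Factors ps qs m ×
    All (multiplicity b ∣_) p × AllExp (multiplicity b ∣_) ps ×
    weight k (map sum (p ∷ ps)) ≡ multiplicity b ℕ.* degree b ×
    atoms k (q ∷ qs) ≡ bs

firstAtom k (row ∷ m) eq
  with p , q , ps , qs , s , ss , d , ds , w , a ← firstAtomRow k row m eq = record
  { factors = s ∷ ss ; powers = d ∷ ds ; powerWeight = w ; restAtoms = a }

firstAtomRow k []           m eq
  with record { power = x ; factors = ss ; powers = ds ; powerWeight = w ; restAtoms = a } ←
         firstAtom (suc k) m eq =
  [] , [] , _ , _ , [] , ss , [] , ds ,
  trans (cong (ℕ._+ weight (suc k) (map sum x)) (ℕ.*-zeroʳ k)) w , a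
firstAtomRow k (zero ∷ es)  m eq
  with p , q , ps , qs , s , ss , d , ds , w , a ← firstAtomRow k es m eq =
  0 ∷ p , 0 ∷ q , ps , qs , refl ∷ s , ss , (_ ∣0) ∷ d , ds , w , a
firstAtomRow k (suc e ∷ es) m refl
  with zs , s , ps ← zeroRow es | zss , ss , pss ← zeroFactor m =
  suc e ∷ zs , 0 ∷ es , zss , m , ℕ.+-identityʳ (suc e) ∷ s , ss ,
  divides 1 (sym (ℕ.*-identityˡ (suc e))) ∷ zeros-divisible (suc e) ps ,
  All.map (zeros-divisible (suc e)) pss ,
  (begin
    k ℕ.* (suc e ℕ.+ sum zs) ℕ.+ weight (suc k) (map sum zss)
      ≡⟨ cong₂ (λ s t → k ℕ.* (suc e ℕ.+ s) ℕ.+ t)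
           (All≡0⇒sum≡0 ps) (AllExp≡0⇒weight≡0 (suc k) pss) ⟩
    k ℕ.* (suc e ℕ.+ 0) ℕ.+ 0
      ≡⟨ trans (ℕ.+-identityʳ _) (cong (k ℕ.*_) (ℕ.+-identityʳ (suc e))) ⟩
    k ℕ.* suc e
      ≡⟨ ℕ.*-comm k (suc e) ⟩
    suc e ℕ.* k ∎) , refl
  where open ≡-Reasoning

atoms≡[]⇒AllExp≡0 : ∀ k m → atoms k m ≡ [] → AllExp (_≡ 0) m
atoms≡[]⇒AllExp≡0 k m eq = total≡0⇒AllExp≡0 m
  (trans (sym (multiplicities-atoms k m)) (cong multiplicities eq))

-- All coefficients are non-negative, so nothing cancels and one factorization with positive
-- coefficients is enough. Equality as lists makes the first block of `bs` belong to the first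
-- variable of `m`.
positive-at-atoms : ∀ bs m → atoms 1 m ≡ bs → Positive (coeff (blocksSeries H bs) m)
positive-at-atoms [] m eq = subst Positive
  (sym (indicator-yes (All.all? (All.all? (ℕ._≟ 0)) m) (atoms≡[]⇒AllExp≡0 1 m eq))) _
positive-at-atoms (block d r ∷ bs) m eq
  with record { power = x ; rest = y ; factors = ss ; powers = ds ; powerWeight = w ; restAtoms = a } ←
         firstAtom 1 m eq =
  sumOver-positive {x = x , y} _
    (λ (x , y) → ℚ.nonNeg*nonNeg⇒nonNeg (coeff (H d ⟨ r ⟩) x) {{H-nonNegative d r x}}
      (coeff (blocksSeries H bs) y) {{blocksSeries-H-nonNegative bs y}})
    (∈-factorizations⁺ ss)
    (ℚ.pos*pos⇒pos (coeff (H d ⟨ r ⟩) x)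
      {{subst Positive (sym (trans (coeff-H d r x) (cong₂ _*_
        (indicator-yes (power? r x) ds) (indicator-yes (deg x ℕ.≟ r ℕ.* d) w)))) _}}
      (coeff (blocksSeries H bs) y) {{positive-at-atoms bs y a}})

-- Test monomials and uniqueness of the expansion

insertExponent : ℕ → ℕ → Monomial → Monomial
insertExponent zero    r []        = (r ∷ []) ∷ []
-- The new exponent goes to the front and shifts the other variables of its row, so it never
-- collides with one of them.
insertExponent zero    r (row ∷ m) = (r ∷ row) ∷ m
insertExponent (suc d) r []        = [] ∷ insertExponent d r []
insertExponent (suc d) r (row ∷ m) = row ∷ insertExponent d r m

atoms-insertExponent : ∀ k d e r m → k ℕ.+ d ≡ e →
  atoms k (insertExponent d (suc r) m) ↭ block e (suc r) ∷ atoms k m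
atoms-insertExponent k zero    e r []        eq =
  Perm.↭-reflexive (cong (λ e → block e (suc r) ∷ []) (trans (sym (ℕ.+-identityʳ k)) eq))
atoms-insertExponent k zero    e r (row ∷ m) eq = Perm.↭-reflexive
  (cong (λ e → block e (suc r) ∷ atoms k (row ∷ m)) (trans (sym (ℕ.+-identityʳ k)) eq))
atoms-insertExponent k (suc d) e r []        eq =
  atoms-insertExponent (suc k) d e r [] (trans (sym (ℕ.+-suc k d)) eq)
atoms-insertExponent k (suc d) e r (row ∷ m) eq = Perm.trans
  (++⁺ˡ (atomsRow k row) (atoms-insertExponent (suc k) d e r m (trans (sym (ℕ.+-suc k d)) eq)))
  (shift (block e (suc r)) (atomsRow k row) (atoms (suc k) m))

monomialOfBlocks : ∀ bs → PositiveDegrees bs → ∃ λ m → atoms 1 m ↭ bs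
monomialOfBlocks []                           []      = [] , Perm.↭-refl
monomialOfBlocks (block (suc d) (suc r) ∷ bs) (_ ∷ pos)
  with m , p ← monomialOfBlocks bs pos =
  insertExponent d (suc r) m ,
  Perm.trans (atoms-insertExponent 1 d (suc d) r m refl) (Perm.prep _ p)

-- Increases with the total multiplicity and, at equal total multiplicity, with
-- a decreasing number of blocks, because length bs ≤ multiplicities bs.
rank : List Block → ℕ
rank bs =
  multiplicities bs ℕ.* suc (multiplicities bs) ℕ.+ (multiplicities bs ∸ length bs)

-- With s < t, the second summand of the smaller rank is at most s, and s(s + 1) + s < (s + 1)² ≤
-- t(t + 1).
rank-< : ∀ {bs cs} → multiplicities bs < multiplicities cs → rank bs < rank cs
rank-< {bs} {cs} lt = begin-strict
  s ℕ.* suc s ℕ.+ (s ∸ length bs)  ≤⟨ ℕ.+-monoʳ-≤ (s ℕ.* suc s) (ℕ.m∸n≤m s (length bs)) ⟩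
  s ℕ.* suc s ℕ.+ s                <⟨ ℕ.+-monoʳ-< (s ℕ.* suc s) (ℕ.n<1+n s) ⟩
  s ℕ.* suc s ℕ.+ suc s            ≡⟨ ℕ.+-comm (s ℕ.* suc s) (suc s) ⟩
  suc s ℕ.* suc s                  ≤⟨ ℕ.*-mono-≤ lt (ℕ.m≤n⇒m≤1+n lt) ⟩
  t ℕ.* suc t                      ≤⟨ ℕ.m≤m+n (t ℕ.* suc t) (t ∸ length cs) ⟩
  t ℕ.* suc t ℕ.+ (t ∸ length cs)  ∎
  where
  open ℕ.≤-Reasoning
  s = multiplicities bs
  t = multiplicities cs

rank-<-length : ∀ {bs cs} → multiplicities bs ≡ multiplicities cs →
                length cs < length bs → rank bs < rank cs
rank-<-length {bs} {cs} eq lt = subst (λ s → s ℕ.* suc s ℕ.+ (s ∸ length bs) < rank cs) (sym eq)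
  (ℕ.+-monoʳ-< (multiplicities cs ℕ.* suc (multiplicities cs))
    (ℕ.∸-monoʳ-< lt (subst (length bs ≤_) eq (length≤multiplicities bs))))

*-cancelʳ-positive : ∀ {p q} h → .{{Positive h}} → p * h ≡ q * h → p ≡ q
*-cancelʳ-positive h eq = ℚ.≤-antisym
  (ℚ.*-cancelʳ-≤-pos h (ℚ.≤-reflexive eq)) (ℚ.*-cancelʳ-≤-pos h (ℚ.≤-reflexive (sym eq)))

-- Both expansions are evaluated at a monomial with one variable per block of `ρ`. By `subordinate`,
-- a type other than `ρ` with non-zero coefficient there has smaller total multiplicity, or the same
-- and more blocks; either way its rank is smaller, and the induction settles it.
H-expansion-unique : ∀ {n} G (c c′ : Typ n → ℚ) →
  IsExpansion (H ⟦_⟧) G c → IsExpansion (H ⟦_⟧) G c′ → ∀ ρ → c ρ ≡ c′ ρ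
H-expansion-unique {n} G c c′ exp exp′ ρ = go ρ (<-wellFounded _)
  where
  go : ∀ ρ → Acc _<_ (rank (blocks ρ)) → c ρ ≡ c′ ρ
  go ρ (acc smaller)
    with m , p ← monomialOfBlocks (blocks ρ) (blocksFrom-positive 1 (toList (value ρ))) =
    *-cancelʳ-positive (h ρ)
      -- The atoms of `m` are the blocks of `ρ` only up to order, which does not affect the product.
      {{subst Positive (blocksSeries-↭ H p m) (positive-at-atoms (atoms 1 m) m refl)}}
      (sumOver-cancel (Enumeration.unique (types n)) (Enumeration.complete (types n) ρ)
        agree (trans (sym (exp m)) (exp′ m)))
    where
    h : Typ n → ℚ
    h τ = coeff (H ⟦ τ ⟧) m
    total≡ : total m ≡ multiplicities (blocks ρ)
    total≡ = trans (sym (multiplicities-atoms 1 m)) (multiplicities-↭ p)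
    agree : ∀ τ → τ ≢ ρ → c τ * h τ ≡ c′ τ * h τ
    agree τ τ≢ρ with h τ ℚ.≟ 0ℚ
    ... | yes h≡0 = trans (cong (c τ *_) h≡0) (trans (ℚ.*-zeroʳ (c τ))
      (sym (trans (cong (c′ τ *_) h≡0) (ℚ.*-zeroʳ (c′ τ)))))
    ... | no h≢0 with subordinate (blocks τ) m (blocksFrom-positive 1 (toList (value τ))) h≢0
    ...   | smaller-total lt = cong (_* h τ) (go τ (smaller
      (rank-< {blocks τ} {blocks ρ} (subst (multiplicities (blocks τ) <_) total≡ lt))))
    ...   | more-blocks eq lt = cong (_* h τ) (go τ (smaller
      (rank-<-length {blocks τ} {blocks ρ} (trans eq total≡)
        (subst (_< length (blocks τ)) (↭-length p) lt))))
    ...   | equal q = contradiction (blocks-injective τ ρ (Perm.trans (Perm.↭-sym q) p)) τ≢ρ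

theorem45 : ∀ (n : ℕ) (σ τ : Typ n) →
    IsCoefficient (H ⟦_⟧) τ (E⁺ ⟦ σ ⟧)
    (∑ (tabloids σ τ) (λ T → (- 1ℚ) ^ ℓ₂ σ τ T))
theorem45 n σ τ =
  ((λ ρ → ∑ (tabloids σ ρ) (λ T → (- 1ℚ) ^ ℓ₂ σ ρ T)) , E⁺-expansion σ ,
    λ {c} c-expansion → H-expansion-unique (E⁺ ⟦ σ ⟧) _ c (E⁺-expansion σ) c-expansion) ,
  refl
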